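{- Let $G$ be a finite simple connected graph, let $\lambda$ be an eigenvalue of the normalized Laplacian $\mathcal{L}$ of $G$, and let $\{x,y\}$ be an edge of $G$. Then the edge derivative of $\lambda$ with respect to $\{x,y\}$ satisfies $$-\lambda \le \frac{d\lambda}{d\{x,y\}} \le 2-\lambda .$$ Moreover, both bounds are tight: there exist a finite simple connected graph, an eigenvalue of its normalized Laplacian and an edge for which equality holds in the lower bound, and likewise there exist such a graph, eigenvalue and edge for which equality holds in the upper bound.
   Context: For a finite simple connected graph $G$ with at least two vertices, $A$ is the adjacency matrix, $d_x$ is the degree of the vertex $x$, $D$ is the diagonal matrix of degrees (invertible), and the normalized Laplacian is $\mathcal{L} = I - D^{ -1/2} A D^{ -1/2}$. Edge derivative: let $\lambda$ be an eigenvalue of $\mathcal{L}$ of multiplicity $k$, let $\mathbf{v}_1,\dots,\mathbf{v}_k$ be an orthonormal basis of the $\lambda$-eigenspace, and write $\mathbf{v}_{i,x}$ for the entry of $\mathbf{v}_i$ at the vertex $x$. For a pair $\{x,y\}$ of distinct vertices (adjacent or not), $$\frac{d\lambda}{d\{x,y\}} = \frac1k\sum_{i=1}^k\left[(1-\lambda)\left(\frac{\mathbf{v}_{i,x}^2}{d_x}+\frac{\mathbf{v}_{i,y}^2}{d_y}\right)-2\,\frac{\mathbf{v}_{i,x}\mathbf{v}_{i,y}}{\sqrt{d_xd_y}}\right].$$ This value does not depend on the choice of the orthonormal basis. (It is the average over $i$ of $\mathbf{v}_i^T \mathcal{L}'(0)\mathbf{v}_i$, where $\mathcal{L}(t)$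 is the normalized Laplacian of the weighted graph obtained from $G$ by adding $t$ to the weight of the pair $\{x,y\}$, edges having weight 1 and non-edges weight 0.) -}

module Defs where

open import Algebra.Bundles using (CommutativeRing)
open import Algebra.Structures using (IsCommutativeRing)
import Algebra.Properties.Semiring.Sum as SemiringSum
open import Data.Bool using (if_then_else_)
open import Data.Empty using (⊥-elim)
open import Data.Fin as Fin using (Fin)
import Data.Fin.Properties as Fin
open import Data.Integer using (+_; +<+)
open import Data.List using (length; filter; allFin)
open import Data.List.Membership.Propositional.Properties using (∈-filter⁺; ∈-allFin; ∈-length)
open import Data.Nat as ℕ using (ℕ; zero; suc; NonZero)
import Data.Nat.Properties as ℕ
open import Data.Product using (∃; _×_; _,_; proj₁; proj₂)
open import Data.Rational as ℚ using (ℚ; mkℚ; 0ℚ; 1ℚ; toℚᵘ; fromℚᵘ; ∣_∣)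
import Data.Rational.Properties as ℚ
open import Data.Rational.Solver using (module +-*-Solver)
open import Data.Rational.Unnormalised as ℚᵘ using (mkℚᵘ)
import Data.Rational.Unnormalised.Properties as ℚᵘ
import Data.Integer as ℤ
import Data.Integer.Properties as ℤ
open import Data.Sum using (inj₁; inj₂)
open import Data.Vec.Functional using (Vector)
open import Level using (0ℓ)
open import Relation.Binary using (Rel; Decidable; Symmetric; Irreflexive; IsEquivalence)
open import Relation.Binary.Construct.Closure.ReflexiveTransitive using (Star; ε; _◅_)
open import Relation.Binary.PropositionalEquality
  using (_≡_; _≢_; refl; sym; trans; cong; cong₂; subst; subst₂; module ≡-Reasoning)
open import Relation.Nullary using (¬_; yes; no; does)

IsCauchy : (ℕ → ℚ) → Set
IsCauchy s = ∀ ε → 0ℚ ℚ.< ε →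
  ∃ λ N → ∀ m n → N ℕ.≤ m → N ℕ.≤ n → ∣ s m ℚ.- s n ∣ ℚ.< ε

-- Cauchy reals, used as a setoid with equality _≈_ below.
record ℝ : Set where
  no-eta-equality
  constructor mkℝ
  field
    seq    : ℕ → ℚ
    cauchy : IsCauchy seq

open ℝ public

infix 4 _≈_ _≤_

record _≈_ (x y : ℝ) : Set where
  constructor mk≈
  field
    close : ∀ ε → 0ℚ ℚ.< ε → ∃ λ N → ∀ n → N ℕ.≤ n → ∣ seq x n ℚ.- seq y n ∣ ℚ.< ε

open _≈_ public

record _≤_ (x y : ℝ) : Set where
  constructor mk≤
  field
    eventually-≤ : ∀ ε → 0ℚ ℚ.< ε → ∃ λ N → ∀ n → N ℕ.≤ n → seq x n ℚ.< seq y n ℚ.+ ε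

open _≤_ public

-- Strict positivity, as a rational lower bound valid from some index on;
-- inversion computes with this data.
record Positive (x : ℝ) : Set where
  constructor mkPositive
  field
    bound     : ℚ
    .{{bound-pos}} : ℚ.Positive bound
    index     : ℕ
    bound-≤   : ∀ n → index ℕ.≤ n → bound ℚ.≤ seq x n

private
  module _ where
    open +-*-Solver

    dist-sym : ∀ a b → ∣ a ℚ.- b ∣ ≡ ∣ b ℚ.- a ∣
    dist-sym a b = trans (cong ∣_∣ (solve 2 (λ a b → a :- b := :- (b :- a)) refl a b))
                         (ℚ.∣-p∣≡∣p∣ (b ℚ.- a))

    dist-triangle : ∀ a b c → ∣ a ℚ.- c ∣ ℚ.≤ ∣ a ℚ.- b ∣ ℚ.+ ∣ b ℚ.- c ∣
    dist-triangle a b c = subst (λ t → ∣ t ∣ ℚ.≤ ∣ a ℚ.- b ∣ ℚ.+ ∣ b ℚ.- c ∣)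
      (solve 3 (λ a b c → (a :- b) :+ (b :- c) := a :- c) refl a b c)
      (ℚ.∣p+q∣≤∣p∣+∣q∣ (a ℚ.- b) (b ℚ.- c))

    dist-+ : ∀ a a′ b b′ →
      ∣ (a ℚ.+ b) ℚ.- (a′ ℚ.+ b′) ∣ ℚ.≤ ∣ a ℚ.- a′ ∣ ℚ.+ ∣ b ℚ.- b′ ∣
    dist-+ a a′ b b′ = subst (λ t → ∣ t ∣ ℚ.≤ ∣ a ℚ.- a′ ∣ ℚ.+ ∣ b ℚ.- b′ ∣)
      (solve 4 (λ a a′ b b′ → (a :- a′) :+ (b :- b′) := (a :+ b) :- (a′ :+ b′)) refl a a′ b b′)
      (ℚ.∣p+q∣≤∣p∣+∣q∣ (a ℚ.- a′) (b ℚ.- b′))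

    dist-* : ∀ a a′ b b′ →
      ∣ a ℚ.* b ℚ.- a′ ℚ.* b′ ∣ ℚ.≤ ∣ a ∣ ℚ.* ∣ b ℚ.- b′ ∣ ℚ.+ ∣ b′ ∣ ℚ.* ∣ a ℚ.- a′ ∣
    dist-* a a′ b b′ = subst₂ ℚ._≤_
      (cong ∣_∣ (solve 4 (λ a a′ b b′ → a :* (b :- b′) :+ b′ :* (a :- a′) := a :* b :- a′ :* b′)
        refl a a′ b b′))
      (cong₂ ℚ._+_ (ℚ.∣p*q∣≡∣p∣*∣q∣ a (b ℚ.- b′)) (ℚ.∣p*q∣≡∣p∣*∣q∣ b′ (a ℚ.- a′)))
      (ℚ.∣p+q∣≤∣p∣+∣q∣ (a ℚ.* (b ℚ.- b′)) (b′ ℚ.* (a ℚ.- a′)))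

    dist-neg : ∀ a b → ∣ (ℚ.- a) ℚ.- (ℚ.- b) ∣ ≡ ∣ a ℚ.- b ∣
    dist-neg a b = trans (cong ∣_∣ (solve 2 (λ a b → (:- a) :- (:- b) := :- (a :- b)) refl a b))
                         (ℚ.∣-p∣≡∣p∣ (a ℚ.- b))

    dist-self : ∀ a b → a ≡ b → ∣ a ℚ.- b ∣ ≡ 0ℚ
    dist-self a .a refl = cong ∣_∣ (ℚ.+-inverseʳ a)

    ½+½ : ∀ e → ℚ.½ ℚ.* e ℚ.+ ℚ.½ ℚ.* e ≡ e
    ½+½ e = trans (sym (ℚ.*-distribʳ-+ e ℚ.½ ℚ.½)) (ℚ.*-identityˡ e)

    add-sub : ∀ a b → b ℚ.+ (a ℚ.- b) ≡ a
    add-sub = solve 2 (λ a b → b :+ (a :- b) := a) refl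

    cancelʳ : ∀ a b → (a ℚ.+ b) ℚ.- b ≡ a
    cancelʳ = solve 2 (λ a b → (a :+ b) :- b := a) refl

  ½-pos : ∀ e → 0ℚ ℚ.< e → 0ℚ ℚ.< ℚ.½ ℚ.* e
  ½-pos e p = ℚ.positive⁻¹ (ℚ.½ ℚ.* e) {{ℚ.pos*pos⇒pos ℚ.½ e {{ℚ.positive p}}}}

  abs-< : ∀ p e → p ℚ.< e → ℚ.- p ℚ.< e → ∣ p ∣ ℚ.< e
  abs-< p e h h′ with ℚ.∣p∣≡p∨∣p∣≡-p p
  ... | inj₁ eq = subst (ℚ._< e) (sym eq) h
  ... | inj₂ eq = subst (ℚ._< e) (sym eq) h′

  sub-< : ∀ a b e → a ℚ.< b ℚ.+ e → a ℚ.- b ℚ.< e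
  sub-< a b e h = subst (a ℚ.- b ℚ.<_)
    (trans (cong (ℚ._- b) (ℚ.+-comm b e)) (cancelʳ e b)) (ℚ.+-monoˡ-< (ℚ.- b) h)

  dist-< : ∀ a b e → a ℚ.< b ℚ.+ e → b ℚ.< a ℚ.+ e → ∣ a ℚ.- b ∣ ℚ.< e
  dist-< a b e h h′ = abs-< (a ℚ.- b) e (sub-< a b e h)
    (subst (ℚ._< e) (solve 2 (λ a b → b :- a := :- (a :- b)) refl a b) (sub-< b a e h′))
    where open +-*-Solver

  module Scale (e K K′ : ℚ) (0<e : 0ℚ ℚ.< e) (0<K : 0ℚ ℚ.< K) (0<K′ : 0ℚ ℚ.< K′) where
    instance
      S-pos : ℚ.Positive (K ℚ.+ K′)
      S-pos = ℚ.pos+pos⇒pos K {{ℚ.positive 0<K}} K′ {{ℚ.positive 0<K′}}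
      S-nonZero : ℚ.NonZero (K ℚ.+ K′)
      S-nonZero = ℚ.pos⇒nonZero (K ℚ.+ K′)

    δ : ℚ
    δ = ℚ.1/ (K ℚ.+ K′) ℚ.* e

    δ-positive : ℚ.Positive δ
    δ-positive = ℚ.pos*pos⇒pos (ℚ.1/ (K ℚ.+ K′)) {{ℚ.1/pos⇒pos (K ℚ.+ K′)}} e {{ℚ.positive 0<e}}

    δ-pos : 0ℚ ℚ.< δ
    δ-pos = ℚ.positive⁻¹ δ {{δ-positive}}

    total : K ℚ.* δ ℚ.+ K′ ℚ.* δ ≡ e
    total = begin
      K ℚ.* δ ℚ.+ K′ ℚ.* δ                          ≡⟨ ℚ.*-distribʳ-+ δ K K′ ⟨
      (K ℚ.+ K′) ℚ.* (ℚ.1/ (K ℚ.+ K′) ℚ.* e)        ≡⟨ ℚ.*-assoc (K ℚ.+ K′) (ℚ.1/ (K ℚ.+ K′)) e ⟨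
      (K ℚ.+ K′) ℚ.* (ℚ.1/ (K ℚ.+ K′)) ℚ.* e        ≡⟨ cong (ℚ._* e) (ℚ.*-inverseʳ (K ℚ.+ K′)) ⟩
      1ℚ ℚ.* e                                      ≡⟨ ℚ.*-identityˡ e ⟩
      e                                             ∎
      where open ≡-Reasoning

    part : ∀ {L} a t → ∣ a ∣ ℚ.< L → ∣ t ∣ ℚ.< δ → ∣ a ∣ ℚ.* ∣ t ∣ ℚ.< L ℚ.* δ
    part {L} a t h h′ = ℚ.≤-<-trans
      (ℚ.*-monoˡ-≤-nonNeg ∣ a ∣ {{ℚ.∣-∣-nonNeg a}} (ℚ.<⇒≤ h′))
      (ℚ.*-monoˡ-<-pos δ {{δ-positive}} h)

    mul-close : ∀ a a′ b b′ → ∣ a ∣ ℚ.< K → ∣ b′ ∣ ℚ.< K′ →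
      ∣ a ℚ.- a′ ∣ ℚ.< δ → ∣ b ℚ.- b′ ∣ ℚ.< δ → ∣ a ℚ.* b ℚ.- a′ ℚ.* b′ ∣ ℚ.< e
    mul-close a a′ b b′ ha hb haa hbb = ℚ.≤-<-trans (dist-* a a′ b b′)
      (subst (∣ a ∣ ℚ.* ∣ b ℚ.- b′ ∣ ℚ.+ ∣ b′ ∣ ℚ.* ∣ a ℚ.- a′ ∣ ℚ.<_) total
        (ℚ.+-mono-< (part a (b ℚ.- b′) ha hbb) (part b′ (a ℚ.- a′) hb haa)))

  sum-close : ∀ e {p q} → p ℚ.< ℚ.½ ℚ.* e → q ℚ.< ℚ.½ ℚ.* e → p ℚ.+ q ℚ.< e
  sum-close e {p} {q} h h′ = subst (p ℚ.+ q ℚ.<_) (½+½ e) (ℚ.+-mono-< h h′)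

  ⊔-l : ∀ {m n o} → m ℕ.⊔ n ℕ.≤ o → m ℕ.≤ o
  ⊔-l {m} {n} = ℕ.m⊔n≤o⇒m≤o m n

  ⊔-r : ∀ {m n o} → m ℕ.⊔ n ℕ.≤ o → n ℕ.≤ o
  ⊔-r {m} {n} = ℕ.m⊔n≤o⇒n≤o m n

  eventually-bounded : ∀ x → ∃ λ K → 0ℚ ℚ.< K × ∃ λ N → ∀ n → N ℕ.≤ n → ∣ seq x n ∣ ℚ.< K
  eventually-bounded x with cauchy x 1ℚ (ℚ.positive⁻¹ 1ℚ)
  ... | N , h = ∣ seq x N ∣ ℚ.+ 1ℚ ,
    ℚ.positive⁻¹ (∣ seq x N ∣ ℚ.+ 1ℚ) {{ℚ.nonNeg+pos⇒pos ∣ seq x N ∣ {{ℚ.∣-∣-nonNeg (seq x N)}} 1ℚ}} ,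
    N , λ n N≤n → ℚ.≤-<-trans
      (subst (λ t → ∣ t ∣ ℚ.≤ ∣ seq x N ∣ ℚ.+ ∣ seq x n ℚ.- seq x N ∣) (add-sub (seq x n) (seq x N))
        (ℚ.∣p+q∣≤∣p∣+∣q∣ (seq x N) (seq x n ℚ.- seq x N)))
      (ℚ.+-monoʳ-< ∣ seq x N ∣ (h n N N≤n ℕ.≤-refl))

private abstract
  const-cauchy : ∀ q → IsCauchy (λ _ → q)
  const-cauchy q e 0<e = 0 , λ _ _ _ _ → subst (ℚ._< e) (sym (dist-self q q refl)) 0<e

fromℚ : ℚ → ℝ
fromℚ q = mkℝ (λ _ → q) (const-cauchy q)

fromℕ : ℕ → ℝ
fromℕ n = fromℚ (+ n ℚ./ 1)

0# 1# : ℝ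
0# = fromℚ 0ℚ
1# = fromℚ 1ℚ

private abstract
  +-cauchy : ∀ x y → IsCauchy (λ n → seq x n ℚ.+ seq y n)
  +-cauchy x y e 0<e =
    let N , h = cauchy x (ℚ.½ ℚ.* e) (½-pos e 0<e)
        M , k = cauchy y (ℚ.½ ℚ.* e) (½-pos e 0<e)
    in N ℕ.⊔ M , λ m n p q → ℚ.≤-<-trans (dist-+ (seq x m) (seq x n) (seq y m) (seq y n))
         (sum-close e (h m n (⊔-l p) (⊔-l q)) (k m n (⊔-r p) (⊔-r q)))

  neg-cauchy : ∀ x → IsCauchy (λ n → ℚ.- seq x n)
  neg-cauchy x e 0<e =
    let N , h = cauchy x e 0<e
    in N , λ m n p q → subst (ℚ._< e) (sym (dist-neg (seq x m) (seq x n))) (h m n p q)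

  *-cauchy : ∀ x y → IsCauchy (λ n → seq x n ℚ.* seq y n)
  *-cauchy x y e 0<e =
    let K  , 0<K  , N₁ , b₁ = eventually-bounded x
        K′ , 0<K′ , N₂ , b₂ = eventually-bounded y
        open Scale e K K′ 0<e 0<K 0<K′
        N₃ , h = cauchy x δ δ-pos
        N₄ , k = cauchy y δ δ-pos
    in (N₁ ℕ.⊔ N₂) ℕ.⊔ (N₃ ℕ.⊔ N₄) , λ m n p q →
         mul-close (seq x m) (seq x n) (seq y m) (seq y n)
           (b₁ m (⊔-l (⊔-l p))) (b₂ n (⊔-r {N₁} (⊔-l q)))
           (h m n (⊔-l (⊔-r {N₁ ℕ.⊔ N₂} p)) (⊔-l (⊔-r {N₁ ℕ.⊔ N₂} q)))
           (k m n (⊔-r {N₃} (⊔-r {N₁ ℕ.⊔ N₂} p)) (⊔-r {N₃} (⊔-r {N₁ ℕ.⊔ N₂} q)))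

infix  8 -_
infixl 7 _*_
infixl 6 _+_ _-_

_+_ : ℝ → ℝ → ℝ
x + y = mkℝ (λ n → seq x n ℚ.+ seq y n) (+-cauchy x y)

-_ : ℝ → ℝ
- x = mkℝ (λ n → ℚ.- seq x n) (neg-cauchy x)

_-_ : ℝ → ℝ → ℝ
x - y = x + - y

_*_ : ℝ → ℝ → ℝ
x * y = mkℝ (λ n → seq x n ℚ.* seq y n) (*-cauchy x y)

pointwise : ∀ x y → (∀ n → seq x n ≡ seq y n) → x ≈ y
pointwise x y eq = mk≈ λ e 0<e → 0 , λ n _ →
  subst (ℚ._< e) (sym (dist-self (seq x n) (seq y n) (eq n))) 0<e

≈-isEquivalence : IsEquivalence _≈_
≈-isEquivalence = record
  { refl  = λ {x} → pointwise x x λ _ → refl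
  ; sym   = λ {x} {y} r → mk≈ λ e 0<e →
      let N , h = close r e 0<e
      in N , λ n p → subst (ℚ._< e) (dist-sym (seq x n) (seq y n)) (h n p)
  ; trans = λ {x} {y} {z} r s → mk≈ λ e 0<e →
      let N , h = close r (ℚ.½ ℚ.* e) (½-pos e 0<e)
          M , k = close s (ℚ.½ ℚ.* e) (½-pos e 0<e)
      in N ℕ.⊔ M , λ n p → ℚ.≤-<-trans (dist-triangle (seq x n) (seq y n) (seq z n))
           (sum-close e (h n (⊔-l p)) (k n (⊔-r p)))
  }

private
  +-cong : ∀ {x x′ y y′} → x ≈ x′ → y ≈ y′ → x + y ≈ x′ + y′
  +-cong {x} {x′} {y} {y′} r s = mk≈ λ e 0<e →
    let N , h = close r (ℚ.½ ℚ.* e) (½-pos e 0<e)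
        M , k = close s (ℚ.½ ℚ.* e) (½-pos e 0<e)
    in N ℕ.⊔ M , λ n p → ℚ.≤-<-trans (dist-+ (seq x n) (seq x′ n) (seq y n) (seq y′ n))
         (sum-close e (h n (⊔-l p)) (k n (⊔-r p)))

  -‿cong : ∀ {x x′} → x ≈ x′ → - x ≈ - x′
  -‿cong {x} {x′} r = mk≈ λ e 0<e →
    let N , h = close r e 0<e
    in N , λ n p → subst (ℚ._< e) (sym (dist-neg (seq x n) (seq x′ n))) (h n p)

  *-cong : ∀ {x x′ y y′} → x ≈ x′ → y ≈ y′ → x * y ≈ x′ * y′
  *-cong {x} {x′} {y} {y′} r s = mk≈ λ e 0<e →
    let K  , 0<K  , N₁ , b₁ = eventually-bounded x
        K′ , 0<K′ , N₂ , b₂ = eventually-bounded y′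
        open Scale e K K′ 0<e 0<K 0<K′
        N₃ , h = close r δ δ-pos
        N₄ , k = close s δ δ-pos
    in (N₁ ℕ.⊔ N₂) ℕ.⊔ (N₃ ℕ.⊔ N₄) , λ n p →
         mul-close (seq x n) (seq x′ n) (seq y n) (seq y′ n)
           (b₁ n (⊔-l (⊔-l p))) (b₂ n (⊔-r {N₁} (⊔-l p)))
           (h n (⊔-l (⊔-r {N₁ ℕ.⊔ N₂} p))) (k n (⊔-r {N₃} (⊔-r {N₁ ℕ.⊔ N₂} p)))

+-*-isCommutativeRing : IsCommutativeRing _≈_ _+_ _*_ -_ 0# 1#
+-*-isCommutativeRing = record
  { isRing = record
    { +-isAbelianGroup = record
      { isGroup = record
        { isMonoid = record
          { isSemigroup = record
            { isMagma = record { isEquivalence = ≈-isEquivalence ; ∙-cong = +-cong }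
            ; assoc   = λ x y z → pointwise (x + y + z) (x + (y + z)) λ n → ℚ.+-assoc (seq x n) (seq y n) (seq z n)
            }
          ; identity = (λ x → pointwise (0# + x) x λ n → ℚ.+-identityˡ (seq x n))
                     , (λ x → pointwise (x + 0#) x λ n → ℚ.+-identityʳ (seq x n))
          }
        ; inverse = (λ x → pointwise (- x + x) 0# λ n → ℚ.+-inverseˡ (seq x n))
                  , (λ x → pointwise (x - x) 0# λ n → ℚ.+-inverseʳ (seq x n))
        ; ⁻¹-cong = -‿cong
        }
      ; comm = λ x y → pointwise (x + y) (y + x) λ n → ℚ.+-comm (seq x n) (seq y n)
      }
    ; *-cong     = *-cong
    ; *-assoc    = λ x y z → pointwise (x * y * z) (x * (y * z)) λ n → ℚ.*-assoc (seq x n) (seq y n) (seq z n)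
    ; *-identity = (λ x → pointwise (1# * x) x λ n → ℚ.*-identityˡ (seq x n))
                 , (λ x → pointwise (x * 1#) x λ n → ℚ.*-identityʳ (seq x n))
    ; distrib    = (λ x y z → pointwise (x * (y + z)) (x * y + x * z) λ n → ℚ.*-distribˡ-+ (seq x n) (seq y n) (seq z n))
                 , (λ x y z → pointwise ((y + z) * x) (y * x + z * x) λ n → ℚ.*-distribʳ-+ (seq x n) (seq y n) (seq z n))
    }
  ; *-comm = λ x y → pointwise (x * y) (y * x) λ n → ℚ.*-comm (seq x n) (seq y n)
  }

ℝ-commutativeRing : CommutativeRing 0ℓ 0ℓ
ℝ-commutativeRing = record { isCommutativeRing = +-*-isCommutativeRing }

open SemiringSum (CommutativeRing.semiring ℝ-commutativeRing) public using (sum; sum-syntax)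

private
  ⊔-pos : ∀ c a .{{_ : ℚ.Positive c}} → ℚ.Positive (c ℚ.⊔ a)
  ⊔-pos c a = ℚ.positive (ℚ.<-≤-trans (ℚ.positive⁻¹ c) (ℚ.p≤p⊔q c a))

  inv⊔ : ∀ c .{{_ : ℚ.Positive c}} → ℚ → ℚ
  inv⊔ c a = (ℚ.1/ (c ℚ.⊔ a)) {{ℚ.pos⇒nonZero (c ℚ.⊔ a) {{⊔-pos c a}}}}

  1/-cong : ∀ {a b} .{{_ : ℚ.NonZero a}} .{{_ : ℚ.NonZero b}} → a ≡ b → ℚ.1/ a ≡ ℚ.1/ b
  1/-cong refl = refl

  inv⊔-≡ : ∀ c a .{{_ : ℚ.Positive c}} .{{_ : ℚ.NonZero a}} → c ℚ.≤ a → inv⊔ c a ≡ ℚ.1/ a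
  inv⊔-≡ c a c≤a = 1/-cong {{ℚ.pos⇒nonZero (c ℚ.⊔ a) {{⊔-pos c a}}}} (ℚ.p≤q⇒p⊔q≡q c≤a)

  inv-close : ∀ c .{{_ : ℚ.Positive c}} a b e → c ℚ.≤ a → c ℚ.≤ b →
    ∣ a ℚ.- b ∣ ℚ.< c ℚ.* c ℚ.* e → ∣ inv⊔ c a ℚ.- inv⊔ c b ∣ ℚ.< e
  inv-close c a b e c≤a c≤b h = subst₂ (λ s t → ∣ s ℚ.- t ∣ ℚ.< e)
    (sym (inv⊔-≡ c a c≤a)) (sym (inv⊔-≡ c b c≤b)) goal
    where
    instance
      a-pos : ℚ.Positive a
      a-pos = ℚ.positive (ℚ.<-≤-trans (ℚ.positive⁻¹ c) c≤a)
      b-pos : ℚ.Positive b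
      b-pos = ℚ.positive (ℚ.<-≤-trans (ℚ.positive⁻¹ c) c≤b)
      a-nz : ℚ.NonZero a
      a-nz = ℚ.pos⇒nonZero a
      b-nz : ℚ.NonZero b
      b-nz = ℚ.pos⇒nonZero b
      cc-pos : ℚ.Positive (c ℚ.* c)
      cc-pos = ℚ.pos*pos⇒pos c c
      c-nn : ℚ.NonNegative c
      c-nn = ℚ.pos⇒nonNeg c
      b-nn : ℚ.NonNegative b
      b-nn = ℚ.pos⇒nonNeg b
    t : ℚ
    t = ℚ.1/ a ℚ.- ℚ.1/ b
    open +-*-Solver
    ab∣t∣ : a ℚ.* b ℚ.* ∣ t ∣ ≡ ∣ a ℚ.- b ∣
    ab∣t∣ = begin
      a ℚ.* b ℚ.* ∣ t ∣
        ≡⟨ cong (ℚ._* ∣ t ∣) (sym (ℚ.0≤p⇒∣p∣≡p (ℚ.<⇒≤ (ℚ.positive⁻¹ (a ℚ.* b) {{ℚ.pos*pos⇒pos a b}})))) ⟩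
      ∣ a ℚ.* b ∣ ℚ.* ∣ t ∣
        ≡⟨ sym (ℚ.∣p*q∣≡∣p∣*∣q∣ (a ℚ.* b) t) ⟩
      ∣ a ℚ.* b ℚ.* t ∣
        ≡⟨ cong ∣_∣ (solve 4 (λ a b i j → a :* b :* (i :- j) := (a :* i) :* b :- (b :* j) :* a) refl a b (ℚ.1/ a) (ℚ.1/ b)) ⟩
      ∣ (a ℚ.* ℚ.1/ a) ℚ.* b ℚ.- (b ℚ.* ℚ.1/ b) ℚ.* a ∣
        ≡⟨ cong₂ (λ u v → ∣ u ℚ.* b ℚ.- v ℚ.* a ∣) (ℚ.*-inverseʳ a) (ℚ.*-inverseʳ b) ⟩
      ∣ 1ℚ ℚ.* b ℚ.- 1ℚ ℚ.* a ∣
        ≡⟨ cong₂ (λ u v → ∣ u ℚ.- v ∣) (ℚ.*-identityˡ b) (ℚ.*-identityˡ a) ⟩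
      ∣ b ℚ.- a ∣
        ≡⟨ dist-sym b a ⟩
      ∣ a ℚ.- b ∣ ∎
      where open ≡-Reasoning
    cc≤ab : c ℚ.* c ℚ.≤ a ℚ.* b
    cc≤ab = ℚ.≤-trans (ℚ.*-monoʳ-≤-nonNeg c c≤a)
                      (ℚ.*-monoˡ-≤-nonNeg a {{ℚ.pos⇒nonNeg a}} c≤b)
    goal : ∣ t ∣ ℚ.< e
    goal = ℚ.*-cancelˡ-<-nonNeg (c ℚ.* c) {{ℚ.pos⇒nonNeg (c ℚ.* c)}}
      (ℚ.≤-<-trans (ℚ.*-monoʳ-≤-nonNeg ∣ t ∣ {{ℚ.∣-∣-nonNeg t}} cc≤ab)
        (subst (ℚ._< c ℚ.* c ℚ.* e) (sym ab∣t∣) h))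

  abstract
    inv-cauchy : ∀ x c .{{c-pos : ℚ.Positive c}} N → (∀ n → N ℕ.≤ n → c ℚ.≤ seq x n) →
      IsCauchy (λ n → inv⊔ c (seq x n))
    inv-cauchy x c {{c-pos}} N c≤ e 0<e =
      let M , h = cauchy x (c ℚ.* c ℚ.* e) pos
      in N ℕ.⊔ M , λ m n p q → inv-close c {{c-pos}} (seq x m) (seq x n) e
           (c≤ m (⊔-l p)) (c≤ n (⊔-l q)) (h m n (⊔-r p) (⊔-r q))
      where
      pos : 0ℚ ℚ.< c ℚ.* c ℚ.* e
      pos = ℚ.positive⁻¹ (c ℚ.* c ℚ.* e)
        {{ℚ.pos*pos⇒pos (c ℚ.* c) {{ℚ.pos*pos⇒pos c {{c-pos}} c {{c-pos}}}} e {{ℚ.positive 0<e}}}}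

-- Only the eventual values of the sequence matter, so its terms may be
-- replaced by their maximum with the eventual positive lower bound.
inv : ∀ x → Positive x → ℝ
inv x (mkPositive c {{c-pos}} N c≤) =
  mkℝ (λ n → inv⊔ c {{c-pos}} (seq x n)) (inv-cauchy x c {{c-pos}} N c≤)

inv-inverse : ∀ x (p : Positive x) → x * inv x p ≈ 1#
inv-inverse x (mkPositive c {{c-pos}} N c≤) = mk≈ λ e 0<e → N , λ n N≤n →
  subst (ℚ._< e) (sym (dist-self _ 1ℚ (eq n N≤n))) 0<e
  where
  eq : ∀ n → N ℕ.≤ n → seq x n ℚ.* inv⊔ c {{c-pos}} (seq x n) ≡ 1ℚ
  eq n N≤n = trans (cong (seq x n ℚ.*_) (inv⊔-≡ c (seq x n) {{c-pos}} {{nz}} (c≤ n N≤n)))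
                   (ℚ.*-inverseʳ (seq x n) {{nz}})
    where
    nz : ℚ.NonZero (seq x n)
    nz = ℚ.pos⇒nonZero (seq x n)
      {{ℚ.positive (ℚ.<-≤-trans (ℚ.positive⁻¹ c {{c-pos}}) (c≤ n N≤n))}}

-- ⌊√n⌋
isqrt : ℕ → ℕ
isqrt zero = 0
isqrt (suc n) with suc (isqrt n) ℕ.* suc (isqrt n) ℕ.≤? suc n
... | yes _ = suc (isqrt n)
... | no  _ = isqrt n

isqrt-spec : ∀ n → isqrt n ℕ.* isqrt n ℕ.≤ n × n ℕ.< suc (isqrt n) ℕ.* suc (isqrt n)
isqrt-spec zero = ℕ.z≤n , ℕ.s≤s ℕ.z≤n
isqrt-spec (suc n) with isqrt-spec n | suc (isqrt n) ℕ.* suc (isqrt n) ℕ.≤? suc n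
... | lo , hi | yes p = p , ℕ.≤-<-trans hi (ℕ.*-mono-< (ℕ.n<1+n (suc (isqrt n))) (ℕ.n<1+n (suc (isqrt n))))
... | lo , hi | no ¬p = ℕ.m≤n⇒m≤1+n lo , ℕ.≰⇒> ¬p

private
  ι : ℕ → ℚ
  ι n = + n ℚ./ 1

  u : ℕ → ℚ
  u n = + 1 ℚ./ suc n

  ι-< : ∀ {m n} → m ℕ.< n → ι m ℚ.< ι n
  ι-< {m} {n} h = ℚ.toℚᵘ-cancel-< (ℚᵘ.<-respʳ-≃ (ℚᵘ.≃-sym (ℚ.toℚᵘ-fromℚᵘ (mkℚᵘ (+ n) 0)))
    (ℚᵘ.<-respˡ-≃ (ℚᵘ.≃-sym (ℚ.toℚᵘ-fromℚᵘ (mkℚᵘ (+ m) 0)))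
      (ℚᵘ.*<* (subst₂ ℤ._<_ (sym (ℤ.*-identityʳ (+ m))) (sym (ℤ.*-identityʳ (+ n))) (+<+ h)))))

  ι-≤ : ∀ {m n} → m ℕ.≤ n → ι m ℚ.≤ ι n
  ι-≤ {m} {n} h with ℕ.m≤n⇒m<n∨m≡n h
  ... | inj₁ m<n  = ℚ.<⇒≤ (ι-< m<n)
  ... | inj₂ refl = ℚ.≤-refl

  mul-/ : ∀ a b c d → (+ a ℚ./ suc c) ℚ.* (+ b ℚ./ suc d) ≡ fromℚᵘ (mkℚᵘ (+ a) c ℚᵘ.* mkℚᵘ (+ b) d)
  mul-/ a b c d = ℚ.toℚᵘ-injective (begin
    toℚᵘ (fromℚᵘ (mkℚᵘ (+ a) c) ℚ.* fromℚᵘ (mkℚᵘ (+ b) d))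
      ≈⟨ ℚ.toℚᵘ-homo-* (fromℚᵘ (mkℚᵘ (+ a) c)) (fromℚᵘ (mkℚᵘ (+ b) d)) ⟩
    toℚᵘ (fromℚᵘ (mkℚᵘ (+ a) c)) ℚᵘ.* toℚᵘ (fromℚᵘ (mkℚᵘ (+ b) d))
      ≈⟨ ℚᵘ.*-cong (ℚ.toℚᵘ-fromℚᵘ (mkℚᵘ (+ a) c)) (ℚ.toℚᵘ-fromℚᵘ (mkℚᵘ (+ b) d)) ⟩
    mkℚᵘ (+ a) c ℚᵘ.* mkℚᵘ (+ b) d
      ≈⟨ ℚᵘ.≃-sym (ℚ.toℚᵘ-fromℚᵘ (mkℚᵘ (+ a) c ℚᵘ.* mkℚᵘ (+ b) d)) ⟩
    toℚᵘ (fromℚᵘ (mkℚᵘ (+ a) c ℚᵘ.* mkℚᵘ (+ b) d)) ∎)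
    where open ℚᵘ.≃-Reasoning

  ι-* : ∀ m n → ι m ℚ.* ι n ≡ ι (m ℕ.* n)
  ι-* m n = trans (mul-/ m n 0 0) (cong (λ i → fromℚᵘ (mkℚᵘ i 0)) (sym (ℤ.pos-* m n)))

  ι-u : ∀ p n → ι p ℚ.* u n ≡ + p ℚ./ suc n
  ι-u p n = trans (mul-/ p 1 0 n) (ℚ.fromℚᵘ-cong {mkℚᵘ (+ p) 0 ℚᵘ.* mkℚᵘ (+ 1) n} {mkℚᵘ (+ p) n} (ℚᵘ.*≡*
    (trans (cong (ℤ._* + suc n) (ℤ.*-identityʳ (+ p)))
      (cong (λ k → + p ℤ.* + k) (sym (ℕ.*-identityˡ (suc n)))))))

  ιu≡1 : ∀ n → ι (suc n) ℚ.* u n ≡ 1ℚ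
  ιu≡1 n = trans (ι-u (suc n) n) (ℚ.fromℚᵘ-cong {mkℚᵘ (+ suc n) n} {mkℚᵘ (+ 1) 0}
    (ℚᵘ.*≡* (ℤ.*-comm (+ suc n) (+ 1))))

  u-pos : ∀ n → ℚ.Positive (u n)
  u-pos n = ℚ.normalize-pos 1 (suc n)

  ιsuc : ∀ n → ι (suc n) ≡ ι n ℚ.+ 1ℚ
  ιsuc n = ℚ.toℚᵘ-injective (begin
    toℚᵘ (fromℚᵘ (mkℚᵘ (+ suc n) 0))      ≈⟨ ℚ.toℚᵘ-fromℚᵘ (mkℚᵘ (+ suc n) 0) ⟩
    mkℚᵘ (+ suc n) 0                      ≈⟨ ℚᵘ.*≡* (cong (ℤ._* + 1) eq) ⟩
    mkℚᵘ (+ n) 0 ℚᵘ.+ ℚᵘ.1ℚᵘ              ≈⟨ ℚᵘ.+-congˡ ℚᵘ.1ℚᵘ (ℚᵘ.≃-sym (ℚ.toℚᵘ-fromℚᵘ (mkℚᵘ (+ n) 0))) ⟩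
    toℚᵘ (ι n) ℚᵘ.+ ℚᵘ.1ℚᵘ                ≈⟨ ℚᵘ.≃-sym (ℚ.toℚᵘ-homo-+ (ι n) 1ℚ) ⟩
    toℚᵘ (ι n ℚ.+ 1ℚ)                     ∎)
    where
    open ℚᵘ.≃-Reasoning
    eq : + suc n ≡ + n ℤ.* + 1 ℤ.+ + 1
    eq = trans (cong +_ (ℕ.+-comm 1 n)) (cong (ℤ._+ + 1) (sym (ℤ.*-identityʳ (+ n))))

-- ⌊√(d (n+1)²)⌋ / (n+1), which lies within 1/(n+1) below √d.
√seq : ℕ → ℕ → ℚ
√seq d n = + isqrt (d ℕ.* (suc n ℕ.* suc n)) ℚ./ suc n

private
  module √-estimates (d n : ℕ) where
    p q : ℕ
    p = isqrt (d ℕ.* (suc n ℕ.* suc n))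
    q = suc n

    s : ℚ
    s = √seq d n

    instance
      u-positive : ℚ.Positive (u n)
      u-positive = u-pos n
      u-nonNeg : ℚ.NonNegative (u n)
      u-nonNeg = ℚ.pos⇒nonNeg (u n)
      uu-pos : ℚ.Positive (u n ℚ.* u n)
      uu-pos = ℚ.pos*pos⇒pos (u n) (u n)
      uu-nonNeg : ℚ.NonNegative (u n ℚ.* u n)
      uu-nonNeg = ℚ.pos⇒nonNeg (u n ℚ.* u n)

    open +-*-Solver

    square : ∀ a → ι (a ℕ.* a) ℚ.* (u n ℚ.* u n) ≡ (ι a ℚ.* u n) ℚ.* (ι a ℚ.* u n)
    square a = trans (cong (ℚ._* (u n ℚ.* u n)) (sym (ι-* a a)))
      (solve 2 (λ a u → (a :* a) :* (u :* u) := (a :* u) :* (a :* u)) refl (ι a) (u n))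

    clear : ι (d ℕ.* (q ℕ.* q)) ℚ.* (u n ℚ.* u n) ≡ ι d
    clear = begin
      ι (d ℕ.* (q ℕ.* q)) ℚ.* (u n ℚ.* u n)            ≡⟨ cong (ℚ._* (u n ℚ.* u n)) (sym (ι-* d (q ℕ.* q))) ⟩
      ι d ℚ.* ι (q ℕ.* q) ℚ.* (u n ℚ.* u n)            ≡⟨ ℚ.*-assoc (ι d) (ι (q ℕ.* q)) (u n ℚ.* u n) ⟩
      ι d ℚ.* (ι (q ℕ.* q) ℚ.* (u n ℚ.* u n))          ≡⟨ cong (ι d ℚ.*_) (square q) ⟩
      ι d ℚ.* ((ι q ℚ.* u n) ℚ.* (ι q ℚ.* u n))        ≡⟨ cong (λ t → ι d ℚ.* (t ℚ.* t)) (ιu≡1 n) ⟩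
      ι d ℚ.* (1ℚ ℚ.* 1ℚ)                              ≡⟨ ℚ.*-identityʳ (ι d) ⟩
      ι d                                              ∎
      where open ≡-Reasoning

    s≡ : ι p ℚ.* u n ≡ s
    s≡ = ι-u p n

    s+u≡ : ι (suc p) ℚ.* u n ≡ s ℚ.+ u n
    s+u≡ = begin
      ι (suc p) ℚ.* u n              ≡⟨ cong (ℚ._* u n) (ιsuc p) ⟩
      (ι p ℚ.+ 1ℚ) ℚ.* u n           ≡⟨ ℚ.*-distribʳ-+ (u n) (ι p) 1ℚ ⟩
      ι p ℚ.* u n ℚ.+ 1ℚ ℚ.* u n     ≡⟨ cong₂ ℚ._+_ s≡ (ℚ.*-identityˡ (u n)) ⟩
      s ℚ.+ u n                      ∎
      where open ≡-Reasoning

    lower : s ℚ.* s ℚ.≤ ι d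
    lower = subst₂ ℚ._≤_ (trans (square p) (cong (λ t → t ℚ.* t) s≡)) clear
      (ℚ.*-monoʳ-≤-nonNeg (u n ℚ.* u n) (ι-≤ (proj₁ (isqrt-spec (d ℕ.* (q ℕ.* q))))))

    upper : ι d ℚ.< (s ℚ.+ u n) ℚ.* (s ℚ.+ u n)
    upper = subst₂ ℚ._<_ clear (trans (square (suc p)) (cong (λ t → t ℚ.* t) s+u≡))
      (ℚ.*-monoˡ-<-pos (u n ℚ.* u n) (ι-< (proj₂ (isqrt-spec (d ℕ.* (q ℕ.* q))))))

    0≤s : 0ℚ ℚ.≤ s
    0≤s = subst₂ ℚ._≤_ (ℚ.*-zeroˡ (u n)) s≡ (ℚ.*-monoʳ-≤-nonNeg (u n) (ι-≤ (ℕ.z≤n {p})))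

    0≤u : 0ℚ ℚ.≤ u n
    0≤u = ℚ.<⇒≤ (ℚ.positive⁻¹ (u n))

    1≤s : .{{NonZero d}} → 1ℚ ℚ.≤ s
    1≤s = subst₂ ℚ._≤_ (ιu≡1 n) s≡ (ℚ.*-monoʳ-≤-nonNeg (u n) (ι-≤ q≤p))
      where
      q≤p : q ℕ.≤ p
      q≤p = ℕ.≮⇒≥ λ p<q → ℕ.<⇒≱ (proj₂ (isqrt-spec (d ℕ.* (q ℕ.* q))))
        (ℕ.≤-trans (ℕ.*-mono-≤ p<q p<q) (ℕ.m≤n*m (q ℕ.* q) d))

    s≤d : s ℚ.≤ ι d
    s≤d = subst (ℚ._≤ ι d) s≡ (subst (ι p ℚ.* u n ℚ.≤_) step (ℚ.*-monoʳ-≤-nonNeg (u n) (ι-≤ p≤dq)))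
      where
      p≤dq : p ℕ.≤ d ℕ.* q
      p≤dq = ℕ.≮⇒≥ λ dq<p → ℕ.<⇒≱ (ℕ.*-mono-< dq<p dq<p)
        (ℕ.≤-trans (proj₁ (isqrt-spec (d ℕ.* (q ℕ.* q)))) (d≤dd d))
        where
        d≤dd : ∀ d → d ℕ.* (q ℕ.* q) ℕ.≤ d ℕ.* q ℕ.* (d ℕ.* q)
        d≤dd zero      = ℕ.z≤n
        d≤dd d@(suc _) = subst (ℕ._≤ d ℕ.* q ℕ.* (d ℕ.* q)) (ℕ.*-assoc d q q)
          (ℕ.*-monoʳ-≤ (d ℕ.* q) (ℕ.m≤n*m q d))
      step : ι (d ℕ.* q) ℚ.* u n ≡ ι d
      step = begin
        ι (d ℕ.* q) ℚ.* u n       ≡⟨ cong (ℚ._* u n) (sym (ι-* d q)) ⟩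
        ι d ℚ.* ι q ℚ.* u n       ≡⟨ ℚ.*-assoc (ι d) (ι q) (u n) ⟩
        ι d ℚ.* (ι q ℚ.* u n)     ≡⟨ cong (ι d ℚ.*_) (ιu≡1 n) ⟩
        ι d ℚ.* 1ℚ                ≡⟨ ℚ.*-identityʳ (ι d) ⟩
        ι d                       ∎
        where open ≡-Reasoning

    u≤1 : u n ℚ.≤ 1ℚ
    u≤1 = subst₂ ℚ._≤_ (ℚ.*-identityˡ (u n)) (ιu≡1 n) (ℚ.*-monoʳ-≤-nonNeg (u n) (ι-≤ {1} {q} (ℕ.s≤s ℕ.z≤n)))

    gap : ι d ℚ.< s ℚ.* s ℚ.+ ι (d ℕ.+ d ℕ.+ 1) ℚ.* u n
    gap = ℚ.<-≤-trans upper (subst (ℚ._≤ s ℚ.* s ℚ.+ ι (d ℕ.+ d ℕ.+ 1) ℚ.* u n)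
      (solve 2 (λ s u → s :* s :+ (s :+ s :+ u) :* u := (s :+ u) :* (s :+ u)) refl s (u n))
      (ℚ.+-monoʳ-≤ (s ℚ.* s) (ℚ.*-monoʳ-≤-nonNeg (u n) bound)))
      where
      ι-+ : ∀ m k → ι m ℚ.+ ι k ≡ ι (m ℕ.+ k)
      ι-+ zero    k = ℚ.+-identityˡ (ι k)
      ι-+ (suc m) k = begin
        ι (suc m) ℚ.+ ι k        ≡⟨ cong (ℚ._+ ι k) (ιsuc m) ⟩
        ι m ℚ.+ 1ℚ ℚ.+ ι k       ≡⟨ solve 3 (λ a b c → a :+ b :+ c := a :+ c :+ b) refl (ι m) 1ℚ (ι k) ⟩
        ι m ℚ.+ ι k ℚ.+ 1ℚ       ≡⟨ cong (ℚ._+ 1ℚ) (ι-+ m k) ⟩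
        ι (m ℕ.+ k) ℚ.+ 1ℚ       ≡⟨ sym (ιsuc (m ℕ.+ k)) ⟩
        ι (suc (m ℕ.+ k))        ∎
        where open ≡-Reasoning
      bound : s ℚ.+ s ℚ.+ u n ℚ.≤ ι (d ℕ.+ d ℕ.+ 1)
      bound = subst (s ℚ.+ s ℚ.+ u n ℚ.≤_)
        (trans (cong (ℚ._+ ι 1) (ι-+ d d)) (ι-+ (d ℕ.+ d) 1))
        (ℚ.+-mono-≤ (ℚ.+-mono-≤ s≤d s≤d) u≤1)

  square-cancel-< : ∀ a b → 0ℚ ℚ.≤ b → a ℚ.* a ℚ.< b ℚ.* b → a ℚ.< b
  square-cancel-< a b 0≤b h with a ℚ.<? b
  ... | yes a<b = a<b
  ... | no  a≮b = ⊥-elim (ℚ.<-irrefl refl (ℚ.<-≤-trans h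
    (ℚ.≤-trans (ℚ.*-monoʳ-≤-nonNeg b {{ℚ.nonNegative 0≤b}} (ℚ.≮⇒≥ a≮b))
               (ℚ.*-monoˡ-≤-nonNeg a {{ℚ.nonNegative (ℚ.≤-trans 0≤b (ℚ.≮⇒≥ a≮b))}} (ℚ.≮⇒≥ a≮b)))))

  archimedean : ∀ e K → 0ℚ ℚ.< e → ∃ λ N → ∀ n → N ℕ.≤ n → ι K ℚ.* u n ℚ.< e
  archimedean e@(mkℚ (+ suc a) b c) K 0<e = K ℕ.* suc b , λ n N≤n →
    subst (ℚ._< e) (sym (ι-u K n)) (ℚ.toℚᵘ-cancel-<
      (ℚᵘ.<-respˡ-≃ (ℚᵘ.≃-sym (ℚ.toℚᵘ-fromℚᵘ (mkℚᵘ (+ K) n)))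
        (ℚᵘ.*<* (subst₂ ℤ._<_ (ℤ.pos-* K (suc b)) (ℤ.pos-* (suc a) (suc n))
          (+<+ (ℕ.<-≤-trans (ℕ.s≤s N≤n) (ℕ.m≤n*m (suc n) (suc a))))))))
  archimedean (mkℚ (+ zero) b c) K (ℚ.*<* (+<+ ()))
  archimedean (mkℚ ℤ.-[1+ a ] b c) K (ℚ.*<* ())

  small-u : ∀ e → 0ℚ ℚ.< e → ∃ λ N → ∀ n → N ℕ.≤ n → u n ℚ.< e
  small-u e 0<e with archimedean e 1 0<e
  ... | N , h = N , λ n p → subst (ℚ._< e) (ℚ.*-identityˡ (u n)) (h n p)

  √seq-< : ∀ d m n → √seq d m ℚ.< √seq d n ℚ.+ u n
  √seq-< d m n = square-cancel-< (√seq d m) (√seq d n ℚ.+ u n)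
    (subst (ℚ._≤ √seq d n ℚ.+ u n) (ℚ.+-identityˡ 0ℚ)
      (ℚ.+-mono-≤ (√-estimates.0≤s d n) (√-estimates.0≤u d n)))
    (ℚ.≤-<-trans (√-estimates.lower d m) (√-estimates.upper d n))

  abstract
    √-cauchy : ∀ d → IsCauchy (√seq d)
    √-cauchy d e 0<e =
      let N , h = small-u e 0<e
      in N , λ m n p q → dist-< (√seq d m) (√seq d n) e
           (ℚ.<-trans (√seq-< d m n) (ℚ.+-monoʳ-< (√seq d n) (h n q)))
           (ℚ.<-trans (√seq-< d n m) (ℚ.+-monoʳ-< (√seq d m) (h m p)))

√ : ℕ → ℝ
√ d = mkℝ (√seq d) (√-cauchy d)

√-square : ∀ d → √ d * √ d ≈ fromℕ d
√-square d = mk≈ λ e 0<e →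
  let N , h = archimedean e (d ℕ.+ d ℕ.+ 1) 0<e
  in N , λ n p → dist-< (√seq d n ℚ.* √seq d n) (ι d) e
       (ℚ.≤-<-trans (√-estimates.lower d n)
         (subst (ℚ._< ι d ℚ.+ e) (ℚ.+-identityʳ (ι d)) (ℚ.+-monoʳ-< (ι d) 0<e)))
       (ℚ.<-trans (√-estimates.gap d n) (ℚ.+-monoʳ-< (√seq d n ℚ.* √seq d n) (h n p)))

√-nonNegative : ∀ d → 0# ≤ √ d
√-nonNegative d = mk≤ λ e 0<e → 0 , λ n _ →
  subst (ℚ._< √seq d n ℚ.+ e) (ℚ.+-identityˡ 0ℚ) (ℚ.+-mono-≤-< (√-estimates.0≤s d n) 0<e)

√-positive : ∀ d .{{_ : NonZero d}} → Positive (√ d)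
√-positive d = mkPositive 1ℚ 0 λ n _ → √-estimates.1≤s d n

fromℕ-positive : ∀ d .{{_ : NonZero d}} → Positive (fromℕ d)
fromℕ-positive d = mkPositive 1ℚ 0 λ _ _ → ι-≤ (ℕ.>-nonZero⁻¹ d)

infixl 7 _/ℕ_ _/√_

_/ℕ_ : ℝ → (d : ℕ) → .{{NonZero d}} → ℝ
x /ℕ d = x * inv (fromℕ d) (fromℕ-positive d)

_/√_ : ℝ → (d : ℕ) → .{{NonZero d}} → ℝ
x /√ d = x * inv (√ d) (√-positive d)

Matrix : ℕ → Set
Matrix n = Fin n → Fin n → ℝ

infixl 7 _⊗_ _·ᵥ_
infixl 6 _⊖_

_⊗_ : ∀ {n} → Matrix n → Matrix n → Matrix n
_⊗_ {n} M N x y = ∑[ z < n ] (M x z * N z y)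

_⊖_ : ∀ {n} → Matrix n → Matrix n → Matrix n
(M ⊖ N) x y = M x y - N x y

_·ᵥ_ : ∀ {n} → Matrix n → Vector ℝ n → Vector ℝ n
_·ᵥ_ {n} M v x = ∑[ y < n ] (M x y * v y)

diagonal : ∀ {n} → Vector ℝ n → Matrix n
diagonal d x y = if does (x Fin.≟ y) then d x else 0#

identity : ∀ {n} → Matrix n
identity = diagonal λ _ → 1#

⟨_,_⟩ : ∀ {n} → Vector ℝ n → Vector ℝ n → ℝ
⟨_,_⟩ {n} v w = ∑[ x < n ] (v x * w x)

record ConnectedGraph : Set₁ where
  field
    order     : ℕ
    2≤order   : 2 ℕ.≤ order
    Adj       : Rel (Fin order) 0ℓ
    adj?      : Decidable Adj
    symmetric : Symmetric Adj
    loopless  : Irreflexive _≡_ Adj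
    connected : ∀ x y → Star Adj x y

  Vertex : Set
  Vertex = Fin order

  degree : Vertex → ℕ
  degree x = length (filter (adj? x) (allFin order))

  instance
    degree-nonZero : ∀ {x} → NonZero (degree x)
    degree-nonZero {x} with other order 2≤order x
      where
      other : ∀ n → 2 ℕ.≤ n → (x : Fin n) → ∃ λ y → x ≢ y
      other (suc zero) (ℕ.s≤s ()) _
      other (suc (suc n)) _ Fin.zero    = Fin.suc Fin.zero , λ ()
      other (suc (suc n)) _ (Fin.suc x) = Fin.zero , λ ()
    ... | y , x≢y with connected x y
    ...   | ε = ⊥-elim (x≢y refl)
    ...   | _◅_ {j = z} xz _ = ℕ.>-nonZero (∈-length (∈-filter⁺ (adj? x) (∈-allFin z) xz))

    degree*degree-nonZero : ∀ {x y} → NonZero (degree x ℕ.* degree y)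
    degree*degree-nonZero {x} {y} = ℕ.m*n≢0 (degree x) (degree y) {{degree-nonZero {x}}} {{degree-nonZero {y}}}

  adjacency : Matrix order
  adjacency x y = if does (adj? x y) then 1# else 0#

  D^-½ : Matrix order
  D^-½ = diagonal λ x → 1# /√ degree x

  normalizedLaplacian : Matrix order
  normalizedLaplacian = identity ⊖ D^-½ ⊗ adjacency ⊗ D^-½

  InEigenspace : ℝ → Vector ℝ order → Set
  InEigenspace λ₀ v = ∀ x → (normalizedLaplacian ·ᵥ v) x ≈ λ₀ * v x

  IsEigenvalue : ℝ → Set
  IsEigenvalue λ₀ = ∃ λ v → InEigenspace λ₀ v × ¬ (∀ x → v x ≈ 0#)

  record OrthonormalEigenbasis (λ₀ : ℝ) (k : ℕ) : Set where
    field
      vector       : Fin k → Vector ℝ order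
      inEigenspace : ∀ i → InEigenspace λ₀ (vector i)
      orthonormal  : ∀ i j → ⟨ vector i , vector j ⟩ ≈ identity i j
      spanning     : ∀ v → InEigenspace λ₀ v →
                     ∃ λ (c : Vector ℝ k) → ∀ x → v x ≈ ∑[ i < k ] (c i * vector i x)

  multiplicity-nonZero : ∀ {λ₀ k} → IsEigenvalue λ₀ → OrthonormalEigenbasis λ₀ k → NonZero k
  multiplicity-nonZero {k = zero} (v , v∈ , v≢0) B =
    ⊥-elim (v≢0 (proj₂ (OrthonormalEigenbasis.spanning B v v∈)))
  multiplicity-nonZero {k = suc _} _ _ = _

  -- dλ/d{x,y}, computed from an orthonormal basis of the λ₀-eigenspace;
  -- k is the multiplicity of λ₀, and the value does not depend on the basis.
  edgeDerivative : ∀ {λ₀ k} → IsEigenvalue λ₀ → OrthonormalEigenbasis λ₀ k → Vertex → Vertex → ℝ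
  edgeDerivative {λ₀} {k} isEigenvalue B x y =
    (∑[ i < k ]
      ((1# - λ₀) * (v i x * v i x /ℕ degree x + v i y * v i y /ℕ degree y)
        - fromℕ 2 * (v i x * v i y /√ (degree x ℕ.* degree y)))) /ℕ k
    where
    open OrthonormalEigenbasis B renaming (vector to v)
    instance
      k-nonZero : NonZero k
      k-nonZero = multiplicity-nonZero isEigenvalue B

{-# OPTIONS --safe #-}
module Submission where

-- Put f x = v x / √(d x) for a unit λ-eigenvector v; then ∑ d x (f x)² = 1 and
-- ∑ₓᵧ Aₓᵧ f x f y = 1 − λ, so ∑ₓᵧ Aₓᵧ (f x ∓ f y)² ≥ 0 gives 0 ≤ λ ≤ 2.  The contribution T
-- of v to the edge derivative satisfies
--   T + λ     = (f x − f y)² + λ (1 − f x² − f y²),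
--   2 − λ − T = (f x + f y)² + (2 − λ) (1 − f x² − f y²),
-- and f x² + f y² ≤ 1 because all degrees are at least 1.  Averaging over the basis gives the
-- bounds.  Both are attained on K₂, whose eigenvalues 0 and 2 have derivative 0.

open import Defs
open import Algebra.Bundles using (CommutativeRing)
import Algebra.Solver.Ring
open import Algebra.Solver.Ring.AlmostCommutativeRing
  using (fromCommutativeRing; _-Raw-AlmostCommutative⟶_)
import Algebra.Properties.Semiring.Sum as SemiringSum
open import Data.Bool using (true; false; if_then_else_)
open import Data.Empty using (⊥-elim)
open import Data.Fin as Fin using (Fin)
open import Data.Fin.Patterns using (0F; 1F)
import Data.Fin.Properties as Fin
import Data.Integer as ℤ
import Data.Integer.Properties as ℤ
open import Data.List as List using (length; filter)
open import Data.Maybe as Maybe using (Maybe)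
open import Data.Nat as ℕ using (ℕ; zero; suc; NonZero)
import Data.Nat.Properties as ℕ
open import Data.Product using (∃; _×_; _,_; Σ-syntax)
open import Data.Rational.Solver using (module +-*-Solver)
open import Data.Rational as ℚ using (ℚ; 0ℚ; 1ℚ; ½; toℚᵘ)
import Data.Rational.Properties as ℚ
open import Data.Rational.Unnormalised as ℚᵘ using (mkℚᵘ)
import Data.Rational.Unnormalised.Properties as ℚᵘ
open import Data.Sum using (inj₁; inj₂)
open import Data.Vec.Functional using (Vector; removeAt)
open import Function using (_∘_)
open import Relation.Binary.Construct.Closure.ReflexiveTransitive using (Star; ε; _◅_)
import Relation.Binary.PropositionalEquality as ≡
open ≡ using (_≡_; _≢_; cong; cong₂; subst; subst₂)
import Relation.Binary.Reasoning.Setoid as SetoidReasoning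
open import Relation.Nullary using (¬_; ¬?; yes; no; does)
open import Relation.Nullary.Decidable using (dec⇒maybe; dec-true; dec-false)
open import Relation.Unary using (Pred; Decidable)

open CommutativeRing ℝ-commutativeRing
  using ( reflexive; refl; sym; trans; +-cong; *-cong; -‿cong; +-assoc
        ; +-identityˡ; +-identityʳ; *-identityˡ; *-identityʳ; zeroˡ; zeroʳ )
open SemiringSum (CommutativeRing.semiring ℝ-commutativeRing)
  using (∑-distrib-+; ∑-comm; *-distribˡ-sum; *-distribʳ-sum; sum-remove; sum-replicate-zero)
  renaming (sum-cong-≋ to sum-cong)

module ≈-Reasoning = SetoidReasoning (CommutativeRing.setoid ℝ-commutativeRing)

-- Non-negativity of Cauchy reals and its closure under sums and products.

p≤∣p∣ : ∀ p → p ℚ.≤ ℚ.∣ p ∣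
p≤∣p∣ p with ℚ.≤-total 0ℚ p
... | inj₁ 0≤p = ℚ.≤-reflexive (≡.sym (ℚ.0≤p⇒∣p∣≡p 0≤p))
... | inj₂ p≤0 = ℚ.≤-trans p≤0 (ℚ.0≤∣p∣ p)

nonNeg : ∀ x → (∀ n → 0ℚ ℚ.≤ seq x n) → 0# ≤ x
nonNeg x 0≤x = mk≤ λ e 0<e → 0 , λ n _ →
  subst (ℚ._< seq x n ℚ.+ e) (ℚ.+-identityˡ 0ℚ) (ℚ.+-mono-≤-< (0≤x n) 0<e)

half-positive : ∀ {e} → 0ℚ ℚ.< e → 0ℚ ℚ.< ½ ℚ.* e
half-positive {e} 0<e = subst (ℚ._< ½ ℚ.* e) (ℚ.*-zeroʳ ½) (ℚ.*-monoʳ-<-pos ½ 0<e)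

halves : ∀ e → ½ ℚ.* e ℚ.+ ½ ℚ.* e ≡ e
halves e = ≡.trans (≡.sym (ℚ.*-distribʳ-+ e ½ ½)) (ℚ.*-identityˡ e)

-- The pattern of all later estimates: a sum of products of non-negative reals is rewritten into the
-- target by a ring identity, and non-negativity is carried along it.
≤-respʳ-≈ : ∀ {x y z} → y ≈ z → x ≤ y → x ≤ z
≤-respʳ-≈ {x} {y} {z} y≈z x≤y = mk≤ λ e 0<e →
  let N , h = eventually-≤ x≤y (½ ℚ.* e) (half-positive 0<e)
      M , k = close y≈z (½ ℚ.* e) (half-positive 0<e)
  in N ℕ.⊔ M , λ n N⊔M≤n → ℚ.<-trans (h n (ℕ.m⊔n≤o⇒m≤o N M N⊔M≤n))
       (step e (seq y n) (seq z n) (k n (ℕ.m⊔n≤o⇒n≤o N M N⊔M≤n)))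
  where
  step : ∀ e b c → ℚ.∣ b ℚ.- c ∣ ℚ.< ½ ℚ.* e → b ℚ.+ ½ ℚ.* e ℚ.< c ℚ.+ e
  step e b c h = subst₂ ℚ._<_
    (solve 3 (λ b c h → (b :- c) :+ (c :+ h) := b :+ h) ≡.refl b c (½ ℚ.* e))
    (≡.trans (solve 2 (λ c h → h :+ (c :+ h) := c :+ (h :+ h)) ≡.refl c (½ ℚ.* e))
      (cong (c ℚ.+_) (halves e)))
    (ℚ.+-monoˡ-< (c ℚ.+ ½ ℚ.* e) (ℚ.≤-<-trans (p≤∣p∣ (b ℚ.- c)) h))
    where open +-*-Solver

0≤-+ : ∀ {x y} → 0# ≤ x → 0# ≤ y → 0# ≤ x + y
0≤-+ {x} {y} 0≤x 0≤y = mk≤ λ e 0<e →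
  let N , h = eventually-≤ 0≤x (½ ℚ.* e) (half-positive 0<e)
      M , k = eventually-≤ 0≤y (½ ℚ.* e) (half-positive 0<e)
  in N ℕ.⊔ M , λ n N⊔M≤n → subst₂ ℚ._<_ (ℚ.+-identityˡ 0ℚ)
       (≡.trans (interchange (seq x n) (½ ℚ.* e) (seq y n)) (cong ((seq x n ℚ.+ seq y n) ℚ.+_) (halves e)))
       (ℚ.+-mono-< (h n (ℕ.m⊔n≤o⇒m≤o N M N⊔M≤n)) (k n (ℕ.m⊔n≤o⇒n≤o N M N⊔M≤n)))
  where
  interchange : ∀ a h b → (a ℚ.+ h) ℚ.+ (b ℚ.+ h) ≡ (a ℚ.+ b) ℚ.+ (h ℚ.+ h)
  interchange = solve 3 (λ a h b → (a :+ h) :+ (b :+ h) := (a :+ b) :+ (h :+ h)) ≡.refl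
    where open +-*-Solver

eventually-≤-bound : ∀ x → ∃ λ K → ℚ.Positive K × ∃ λ N → ∀ n → N ℕ.≤ n → seq x n ℚ.≤ K
eventually-≤-bound x with cauchy x 1ℚ (ℚ.positive⁻¹ 1ℚ)
... | N , h = ℚ.∣ seq x N ∣ ℚ.+ 1ℚ ,
  ℚ.nonNeg+pos⇒pos ℚ.∣ seq x N ∣ {{ℚ.∣-∣-nonNeg (seq x N)}} 1ℚ , N , λ n N≤n → 
  subst (ℚ._≤ ℚ.∣ seq x N ∣ ℚ.+ 1ℚ) (cancel (seq x N) (seq x n))
    (ℚ.+-mono-≤ (p≤∣p∣ (seq x N))
      (ℚ.<⇒≤ (ℚ.≤-<-trans (p≤∣p∣ (seq x n ℚ.- seq x N)) (h n N N≤n ℕ.≤-refl))))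
  where
  cancel : ∀ a b → a ℚ.+ (b ℚ.- a) ≡ b
  cancel = solve 2 (λ a b → a :+ (b :- a) := b) ≡.refl
    where open +-*-Solver

-- The terms of a non-negative real may be slightly negative, so only `-δ` is available as a lower
-- bound. If one factor is non-negative, the product is at least that factor times `-δ`, hence at
-- least `-Kδ`; if both are non-positive, the product is at least 0.
*-lower-bound : ∀ {K δ x y} → 0ℚ ℚ.≤ K → 0ℚ ℚ.≤ δ → x ℚ.≤ K → y ℚ.≤ K →
  ℚ.- δ ℚ.≤ x → ℚ.- δ ℚ.≤ y → K ℚ.* (ℚ.- δ) ℚ.≤ x ℚ.* y
*-lower-bound {K} {δ} {x} {y} 0≤K 0≤δ x≤K y≤K -δ≤x -δ≤y with ℚ.≤-total 0ℚ x | ℚ.≤-total 0ℚ y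
... | inj₁ 0≤x | _ = ℚ.≤-trans
  (ℚ.*-monoʳ-≤-nonPos (ℚ.- δ) {{ℚ.nonPositive (ℚ.neg-antimono-≤ 0≤δ)}} x≤K)
  (ℚ.*-monoˡ-≤-nonNeg x {{ℚ.nonNegative 0≤x}} -δ≤y)
... | inj₂ _ | inj₁ 0≤y = subst (K ℚ.* (ℚ.- δ) ℚ.≤_) (ℚ.*-comm y x) (ℚ.≤-trans
  (ℚ.*-monoʳ-≤-nonPos (ℚ.- δ) {{ℚ.nonPositive (ℚ.neg-antimono-≤ 0≤δ)}} y≤K)
  (ℚ.*-monoˡ-≤-nonNeg y {{ℚ.nonNegative 0≤y}} -δ≤x))
... | inj₂ x≤0 | inj₂ y≤0 = ℚ.≤-trans
  (subst (K ℚ.* (ℚ.- δ) ℚ.≤_) (ℚ.*-zeroʳ K)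
    (ℚ.*-monoˡ-≤-nonNeg K {{ℚ.nonNegative 0≤K}} (ℚ.neg-antimono-≤ 0≤δ)))
  (subst (ℚ._≤ x ℚ.* y) (ℚ.*-zeroʳ x) (ℚ.*-monoˡ-≤-nonPos x {{ℚ.nonPositive x≤0}} y≤0))

0≤-* : ∀ {x y} → 0# ≤ x → 0# ≤ y → 0# ≤ x * y
0≤-* {x} {y} 0≤x 0≤y = mk≤ λ e 0<e →
  let Kx , Kx-pos , N₁ , x≤Kx = eventually-≤-bound x
      Ky , Ky-pos , N₂ , y≤Ky = eventually-≤-bound y
      K = Kx ℚ.⊔ Ky
      0<K = ℚ.<-≤-trans (ℚ.positive⁻¹ Kx {{Kx-pos}}) (ℚ.p≤p⊔q Kx Ky)
      -- With δ = e / (2K) the product is eventually at least -e/2, which exceeds -e.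
      δ , 0<δ , Kδ≡e/2 = quotient K (½ ℚ.* e) 0<K (half-positive 0<e)
      N₃ , h = eventually-≤ 0≤x δ 0<δ
      N₄ , k = eventually-≤ 0≤y δ 0<δ
  in (N₁ ℕ.⊔ N₂) ℕ.⊔ (N₃ ℕ.⊔ N₄) , λ n n≥ →
     let n≥₁ = ℕ.m⊔n≤o⇒m≤o (N₁ ℕ.⊔ N₂) (N₃ ℕ.⊔ N₄) n≥
         n≥₂ = ℕ.m⊔n≤o⇒n≤o (N₁ ℕ.⊔ N₂) (N₃ ℕ.⊔ N₄) n≥
     in step e K δ (seq x n ℚ.* seq y n) 0<e Kδ≡e/2
       (*-lower-bound {K} {δ} {seq x n} {seq y n} (ℚ.<⇒≤ 0<K) (ℚ.<⇒≤ 0<δ)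
         (ℚ.≤-trans (x≤Kx n (ℕ.m⊔n≤o⇒m≤o N₁ N₂ n≥₁)) (ℚ.p≤p⊔q Kx Ky))
         (ℚ.≤-trans (y≤Ky n (ℕ.m⊔n≤o⇒n≤o N₁ N₂ n≥₁)) (ℚ.p≤q⊔p Kx Ky))
         (ℚ.<⇒≤ (move (seq x n) δ (h n (ℕ.m⊔n≤o⇒m≤o N₃ N₄ n≥₂))))
         (ℚ.<⇒≤ (move (seq y n) δ (k n (ℕ.m⊔n≤o⇒n≤o N₃ N₄ n≥₂)))))
  where
  open +-*-Solver
  quotient : ∀ a b → 0ℚ ℚ.< a → 0ℚ ℚ.< b → ∃ λ q → 0ℚ ℚ.< q × a ℚ.* q ≡ b
  quotient a b 0<a 0<b = (ℚ.1/ a) ℚ.* b ,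
    ℚ.positive⁻¹ ((ℚ.1/ a) ℚ.* b) {{ℚ.pos*pos⇒pos (ℚ.1/ a) {{ℚ.1/pos⇒pos a}} b}} ,
    ≡.trans (≡.sym (ℚ.*-assoc a (ℚ.1/ a) b)) (≡.trans (cong (ℚ._* b) (ℚ.*-inverseʳ a)) (ℚ.*-identityˡ b))
    where
    instance
      a-pos : ℚ.Positive a
      a-pos = ℚ.positive 0<a
      b-pos : ℚ.Positive b
      b-pos = ℚ.positive 0<b
      a-nonZero : ℚ.NonZero a
      a-nonZero = ℚ.pos⇒nonZero a
  move : ∀ a d → 0ℚ ℚ.< a ℚ.+ d → ℚ.- d ℚ.< a
  move a d h = subst₂ ℚ._<_ (ℚ.+-identityˡ (ℚ.- d))
    (solve 2 (λ a d → (a :+ d) :+ (:- d) := a) ≡.refl a d) (ℚ.+-monoˡ-< (ℚ.- d) h)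
  step : ∀ e K δ p → 0ℚ ℚ.< e → K ℚ.* δ ≡ ½ ℚ.* e → K ℚ.* (ℚ.- δ) ℚ.≤ p → 0ℚ ℚ.< p ℚ.+ e
  step e K δ p 0<e eq h = ℚ.<-≤-trans (half-positive 0<e)
    (subst (ℚ._≤ p ℚ.+ e)
      (≡.trans (cong₂ ℚ._+_ (≡.trans (≡.sym (ℚ.neg-distribʳ-* K δ)) (cong ℚ.-_ eq)) (≡.sym (halves e)))
        (solve 1 (λ h → (:- h) :+ (h :+ h) := h) ≡.refl (½ ℚ.* e)))
      (ℚ.+-monoˡ-≤ e h))

0≤y-x⇒x≤y : ∀ {x y} → 0# ≤ y - x → x ≤ y
0≤y-x⇒x≤y {x} {y} 0≤y-x = mk≤ λ e 0<e →
  let N , h = eventually-≤ 0≤y-x e 0<e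
  in N , λ n N≤n → subst₂ ℚ._<_ (ℚ.+-identityˡ (seq x n)) (rearrange (seq x n) (seq y n) e)
       (ℚ.+-monoˡ-< (seq x n) (h n N≤n))
  where
  rearrange : ∀ a b e → ((b ℚ.- a) ℚ.+ e) ℚ.+ a ≡ b ℚ.+ e
  rearrange = solve 3 (λ a b e → ((b :- a) :+ e) :+ a := b :+ e) ≡.refl
    where open +-*-Solver

-- The case split is made on each rational term: the sign of a real is not decidable, so `0≤-*`
-- cannot give this.
0≤x² : ∀ x → 0# ≤ x * x
0≤x² x = nonNeg (x * x) λ n → 0≤p² (seq x n)
  where
  0≤p² : ∀ p → 0ℚ ℚ.≤ p ℚ.* p
  0≤p² p with ℚ.≤-total 0ℚ p
  ... | inj₁ 0≤p = subst (ℚ._≤ p ℚ.* p) (ℚ.*-zeroʳ p) (ℚ.*-monoˡ-≤-nonNeg p {{ℚ.nonNegative 0≤p}} 0≤p)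
  ... | inj₂ p≤0 = subst (ℚ._≤ p ℚ.* p) (ℚ.*-zeroʳ p) (ℚ.*-monoˡ-≤-nonPos p {{ℚ.nonPositive p≤0}} p≤0)

-- A ring solver for the reals with rational constants.

fromℚ-homomorphism :
  CommutativeRing.rawRing ℚ.+-*-commutativeRing -Raw-AlmostCommutative⟶ fromCommutativeRing ℝ-commutativeRing
fromℚ-homomorphism = record
  { ⟦_⟧    = fromℚ
  ; +-homo = λ p q → pointwise (fromℚ (p ℚ.+ q)) (fromℚ p + fromℚ q) λ _ → ≡.refl
  ; *-homo = λ p q → pointwise (fromℚ (p ℚ.* q)) (fromℚ p * fromℚ q) λ _ → ≡.refl
  ; -‿homo = λ p → pointwise (fromℚ (ℚ.- p)) (- fromℚ p) λ _ → ≡.refl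
  ; 0-homo = refl
  ; 1-homo = refl
  }

fromℚ-≈? : ∀ p q → Maybe (fromℚ p ≈ fromℚ q)
fromℚ-≈? p q = Maybe.map (reflexive ∘ cong fromℚ) (dec⇒maybe (p ℚ.≟ q))

-- Coefficients are taken in ℚ, whose equality, unlike that of ℝ, is decidable.
module RingSolver = Algebra.Solver.Ring (CommutativeRing.rawRing ℚ.+-*-commutativeRing)
  (fromCommutativeRing ℝ-commutativeRing) fromℚ-homomorphism fromℚ-≈?
open RingSolver

⟨0⟩ ⟨1⟩ ⟨2⟩ : ∀ {m} → Polynomial m
⟨0⟩ = con 0ℚ
⟨1⟩ = con 1ℚ
⟨2⟩ = con (ℤ.+ 2 ℚ./ 1)

-- Non-negative sums and natural numbers as reals.

0≤0 : 0# ≤ 0#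
0≤0 = nonNeg 0# λ _ → ℚ.≤-refl

0≤fromℕ : ∀ n → 0# ≤ fromℕ n
0≤fromℕ n = nonNeg (fromℕ n) λ _ → ℚ.nonNegative⁻¹ (ℤ.+ n ℚ./ 1) {{ℚ.normalize-nonNeg n 1}}

0≤-sum : ∀ {n} (t : Vector ℝ n) → (∀ i → 0# ≤ t i) → 0# ≤ sum t
0≤-sum {zero}  t 0≤t = 0≤0
0≤-sum {suc n} t 0≤t = 0≤-+ (0≤t 0F) (0≤-sum (t ∘ Fin.suc) (0≤t ∘ Fin.suc))

fromℕ-suc : ∀ n → fromℕ (suc n) ≈ 1# + fromℕ n
fromℕ-suc n = pointwise (fromℕ (suc n)) (1# + fromℕ n) λ _ → ℚ.toℚᵘ-injective (begin
  toℚᵘ (ℤ.+ suc n ℚ./ 1)              ≈⟨ ℚ.toℚᵘ-fromℚᵘ (mkℚᵘ (ℤ.+ suc n) 0) ⟩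
  mkℚᵘ (ℤ.+ suc n) 0
    ≈⟨ ℚᵘ.*≡* (cong (λ i → (ℤ.+ 1 ℤ.+ i) ℤ.* ℤ.+ 1) (≡.sym (ℤ.*-identityʳ (ℤ.+ n)))) ⟩
  ℚᵘ.1ℚᵘ ℚᵘ.+ mkℚᵘ (ℤ.+ n) 0          ≈⟨ ℚᵘ.+-congʳ ℚᵘ.1ℚᵘ (ℚ.toℚᵘ-fromℚᵘ (mkℚᵘ (ℤ.+ n) 0)) ⟨
  toℚᵘ 1ℚ ℚᵘ.+ toℚᵘ (ℤ.+ n ℚ./ 1)     ≈⟨ ℚ.toℚᵘ-homo-+ 1ℚ (ℤ.+ n ℚ./ 1) ⟨
  toℚᵘ (1ℚ ℚ.+ ℤ.+ n ℚ./ 1)           ∎)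
  where open ℚᵘ.≃-Reasoning

fromℕ-+ : ∀ m n → fromℕ (m ℕ.+ n) ≈ fromℕ m + fromℕ n
fromℕ-+ zero    n = sym (+-identityˡ (fromℕ n))
fromℕ-+ (suc m) n = begin
  fromℕ (suc (m ℕ.+ n))          ≈⟨ fromℕ-suc (m ℕ.+ n) ⟩
  1# + fromℕ (m ℕ.+ n)           ≈⟨ +-cong refl (fromℕ-+ m n) ⟩
  1# + (fromℕ m + fromℕ n)       ≈⟨ +-assoc 1# (fromℕ m) (fromℕ n) ⟨
  1# + fromℕ m + fromℕ n         ≈⟨ +-cong (fromℕ-suc m) refl ⟨
  fromℕ (suc m) + fromℕ n        ∎
  where open ≈-Reasoning

fromℕ-* : ∀ m n → fromℕ (m ℕ.* n) ≈ fromℕ m * fromℕ n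
fromℕ-* zero    n = sym (zeroˡ (fromℕ n))
fromℕ-* (suc m) n = begin
  fromℕ (n ℕ.+ m ℕ.* n)            ≈⟨ fromℕ-+ n (m ℕ.* n) ⟩
  fromℕ n + fromℕ (m ℕ.* n)        ≈⟨ +-cong refl (fromℕ-* m n) ⟩
  fromℕ n + fromℕ m * fromℕ n
    ≈⟨ solve 2 (λ a b → b :+ a :* b := (⟨1⟩ :+ a) :* b) refl (fromℕ m) (fromℕ n) ⟩
  (1# + fromℕ m) * fromℕ n         ≈⟨ *-cong (fromℕ-suc m) refl ⟨
  fromℕ (suc m) * fromℕ n          ∎
  where open ≈-Reasoning

sum-const : ∀ k a → ∑[ i < k ] a ≈ fromℕ k * a
sum-const zero    a = sym (zeroˡ a)
sum-const (suc k) a = begin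
  a + ∑[ i < k ] a        ≈⟨ +-cong refl (sum-const k a) ⟩
  a + fromℕ k * a         ≈⟨ solve 2 (λ k a → a :+ k :* a := (⟨1⟩ :+ k) :* a) refl (fromℕ k) a ⟩
  (1# + fromℕ k) * a      ≈⟨ *-cong (fromℕ-suc k) refl ⟨
  fromℕ (suc k) * a       ∎
  where open ≈-Reasoning

-- Inverses, square roots and the weights 1/√d.

inverse-unique : ∀ {x y z} → x * y ≈ 1# → x * z ≈ 1# → y ≈ z
inverse-unique {x} {y} {z} xy≈1 xz≈1 = begin
  y              ≈⟨ *-identityˡ y ⟨
  1# * y         ≈⟨ *-cong xz≈1 refl ⟨
  x * z * y      ≈⟨ solve 3 (λ x y z → x :* z :* y := x :* y :* z) refl x y z ⟩
  x * y * z      ≈⟨ *-cong xy≈1 refl ⟩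
  1# * z         ≈⟨ *-identityˡ z ⟩
  z              ∎
  where open ≈-Reasoning

-- Writing the inverse as i = i²x exhibits it as a product of non-negative factors, without
-- unfolding the sequence behind `inv`.
0≤inv : ∀ {x} (p : Positive x) → 0# ≤ x → 0# ≤ inv x p
0≤inv {x} p 0≤x = ≤-respʳ-≈ i²x≈i (0≤-* (0≤x² i) 0≤x)
  where
  open ≈-Reasoning
  i = inv x p
  i²x≈i : i * i * x ≈ i
  i²x≈i = begin
    i * i * x      ≈⟨ solve 2 (λ i x → i :* i :* x := i :* (x :* i)) refl i x ⟩
    i * (x * i)    ≈⟨ *-cong refl (inv-inverse x p) ⟩
    i * 1#         ≈⟨ *-identityʳ i ⟩
    i              ∎

Positive-+ : ∀ {x y} → Positive x → Positive y → Positive (x + y)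
Positive-+ (mkPositive a {{a-pos}} N h) (mkPositive b {{b-pos}} M k) =
  mkPositive (a ℚ.+ b) {{ℚ.pos+pos⇒pos a {{a-pos}} b {{b-pos}}}} (N ℕ.⊔ M) λ n N⊔M≤n →
    ℚ.+-mono-≤ (h n (ℕ.m⊔n≤o⇒m≤o N M N⊔M≤n)) (k n (ℕ.m⊔n≤o⇒n≤o N M N⊔M≤n))

Positive-* : ∀ {x y} → Positive x → Positive y → Positive (x * y)
Positive-* {x} (mkPositive a {{a-pos}} N h) (mkPositive b {{b-pos}} M k) =
  mkPositive (a ℚ.* b) {{ℚ.pos*pos⇒pos a {{a-pos}} b {{b-pos}}}} (N ℕ.⊔ M) λ n N⊔M≤n →
    let a≤x = h n (ℕ.m⊔n≤o⇒m≤o N M N⊔M≤n)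
        0≤x = ℚ.≤-trans (ℚ.<⇒≤ (ℚ.positive⁻¹ a {{a-pos}})) a≤x
    in ℚ.≤-trans (ℚ.*-monoʳ-≤-nonNeg b {{ℚ.pos⇒nonNeg b {{b-pos}}}} a≤x)
         (ℚ.*-monoˡ-≤-nonNeg (seq x n) {{ℚ.nonNegative 0≤x}} (k n (ℕ.m⊔n≤o⇒n≤o N M N⊔M≤n)))

-- Since `s + t` is positive it has an inverse, and s - t = (s² - t²) / (s + t), which vanishes.
positive-square-injective : ∀ {s t} → Positive s → Positive t → s * s ≈ t * t → s ≈ t
positive-square-injective {s} {t} s>0 t>0 s²≈t² = begin
  s                              ≈⟨ solve 2 (λ s t → s := t :+ (s :- t) :* ⟨1⟩) refl s t ⟩
  t + (s - t) * 1#               ≈⟨ +-cong refl (*-cong refl (inv-inverse (s + t) s+t>0)) ⟨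
  t + (s - t) * ((s + t) * i)
    ≈⟨ solve 3 (λ s t i → t :+ (s :- t) :* ((s :+ t) :* i) := t :+ (s :* s :- t :* t) :* i) refl s t i ⟩
  t + (s * s - t * t) * i        ≈⟨ +-cong refl (*-cong (+-cong s²≈t² refl) refl) ⟩
  t + (t * t - t * t) * i        ≈⟨ solve 2 (λ t i → t :+ (t :* t :- t :* t) :* i := t) refl t i ⟩
  t                              ∎
  where
  open ≈-Reasoning
  s+t>0 = Positive-+ s>0 t>0
  i = inv (s + t) s+t>0

-- The approximating sequences use integer square roots and are not multiplicative term by term.
-- Both sides are positive reals with square ab, which determines them.
√-* : ∀ a b .{{_ : NonZero a}} .{{_ : NonZero b}} → √ (a ℕ.* b) ≈ √ a * √ b
√-* a b = positive-square-injective (√-positive (a ℕ.* b) {{ℕ.m*n≢0 a b}})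
  (Positive-* (√-positive a) (√-positive b)) (begin
    √ (a ℕ.* b) * √ (a ℕ.* b)          ≈⟨ √-square (a ℕ.* b) ⟩
    fromℕ (a ℕ.* b)                    ≈⟨ fromℕ-* a b ⟩
    fromℕ a * fromℕ b                  ≈⟨ *-cong (√-square a) (√-square b) ⟨
    (√ a * √ a) * (√ b * √ b)
      ≈⟨ solve 2 (λ a b → (a :* a) :* (b :* b) := (a :* b) :* (a :* b)) refl (√ a) (√ b) ⟩
    (√ a * √ b) * (√ a * √ b)          ∎)
  where open ≈-Reasoning

√-inverse : ∀ d .{{_ : NonZero d}} → √ d * (1# /√ d) ≈ 1#
√-inverse d = trans (*-cong refl (*-identityˡ _)) (inv-inverse (√ d) (√-positive d))

fromℕ-/√² : ∀ d .{{_ : NonZero d}} → fromℕ d * ((1# /√ d) * (1# /√ d)) ≈ 1#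
fromℕ-/√² d = begin
  fromℕ d * (w * w)          ≈⟨ *-cong (√-square d) refl ⟨
  (√ d * √ d) * (w * w)      ≈⟨ solve 2 (λ s w → (s :* s) :* (w :* w) := (s :* w) :* (s :* w)) refl (√ d) w ⟩
  (√ d * w) * (√ d * w)      ≈⟨ *-cong (√-inverse d) (√-inverse d) ⟩
  1# * 1#                    ≈⟨ *-identityˡ 1# ⟩
  1#                         ∎
  where
  open ≈-Reasoning
  w = 1# /√ d

-- Expresses division by a degree through the weight 1/√d. Together with `/√-*-≈` it makes the edge
-- derivative polynomial in the weights, within reach of the ring solver.
/ℕ-≈ : ∀ x d .{{_ : NonZero d}} → x /ℕ d ≈ x * ((1# /√ d) * (1# /√ d))
/ℕ-≈ x d = *-cong refl (inverse-unique (inv-inverse (fromℕ d) (fromℕ-positive d)) (fromℕ-/√² d))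

/√-*-≈ : ∀ x a b .{{_ : NonZero a}} .{{_ : NonZero b}} .{{_ : NonZero (a ℕ.* b)}} →
  x /√ (a ℕ.* b) ≈ x * ((1# /√ a) * (1# /√ b))
/√-*-≈ x a b = *-cong refl (inverse-unique (inv-inverse (√ (a ℕ.* b)) (√-positive (a ℕ.* b))) (begin
  √ (a ℕ.* b) * (w * w′)         ≈⟨ *-cong (√-* a b) refl ⟩
  (√ a * √ b) * (w * w′)
    ≈⟨ solve 4 (λ s t w w′ → (s :* t) :* (w :* w′) := (s :* w) :* (t :* w′)) refl (√ a) (√ b) w w′ ⟩
  (√ a * w) * (√ b * w′)         ≈⟨ *-cong (√-inverse a) (√-inverse b) ⟩
  1# * 1#                        ≈⟨ *-identityˡ 1# ⟩
  1#                             ∎))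
  where
  open ≈-Reasoning
  w = 1# /√ a
  w′ = 1# /√ b

-- With d = m + 1 the difference 1 - 1/d is m/d, that is, m times the square of the weight.
/√²-≤1 : ∀ d .{{_ : NonZero d}} → 0# ≤ 1# - (1# /√ d) * (1# /√ d)
/√²-≤1 d@(suc m) = ≤-respʳ-≈ (begin
  fromℕ m * (w * w)
    ≈⟨ solve 2 (λ m w → m :* (w :* w) := (⟨1⟩ :+ m) :* (w :* w) :- w :* w) refl (fromℕ m) w ⟩
  (1# + fromℕ m) * (w * w) - w * w      ≈⟨ +-cong (*-cong (fromℕ-suc m) refl) refl ⟨
  fromℕ d * (w * w) - w * w             ≈⟨ +-cong (fromℕ-/√² d) refl ⟩
  1# - w * w                            ∎)
  (0≤-* (0≤fromℕ m) (0≤x² w))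
  where
  open ≈-Reasoning
  w = 1# /√ d

-- Averaging fixes the constant `a` and commutes with scaling by `σ`, so a bound of this affine form
-- that holds for every basis vector passes to the average over the basis.
mean-affine : ∀ k .{{_ : NonZero k}} (σ a : ℝ) (t : Vector ℝ k) →
  (∑[ i < k ] (a + σ * t i)) /ℕ k ≈ a + σ * (sum t /ℕ k)
mean-affine k σ a t = begin
  (∑[ i < k ] (a + σ * t i)) * i                    ≈⟨ *-cong (∑-distrib-+ (λ _ → a) (λ i → σ * t i)) refl ⟩
  (∑[ i < k ] a + ∑[ i < k ] (σ * t i)) * i
    ≈⟨ *-cong (+-cong (sum-const k a) (sym (*-distribˡ-sum σ t))) refl ⟩
  (fromℕ k * a + σ * sum t) * i
    ≈⟨ solve 5 (λ k a σ s i → (k :* a :+ σ :* s) :* i := (k :* i) :* a :+ σ :* (s :* i))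
        refl (fromℕ k) a σ (sum t) i ⟩
  (fromℕ k * i) * a + σ * (sum t * i)
    ≈⟨ +-cong (trans (*-cong (inv-inverse (fromℕ k) (fromℕ-positive k)) refl) (*-identityˡ a)) refl ⟩
  a + σ * (sum t * i)                               ∎
  where
  open ≈-Reasoning
  i = inv (fromℕ k) (fromℕ-positive k)

0≤-mean-affine : ∀ k .{{_ : NonZero k}} (σ a : ℝ) (t : Vector ℝ k) →
  (∀ i → 0# ≤ a + σ * t i) → 0# ≤ a + σ * (sum t /ℕ k)
0≤-mean-affine k σ a t 0≤t = ≤-respʳ-≈ (mean-affine k σ a t)
  (0≤-* (0≤-sum _ 0≤t) (0≤inv (fromℕ-positive k) (0≤fromℕ k)))

-- Finite sums with distinguished terms, diagonal matrices and counting.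

sum-zero : ∀ {n} (t : Vector ℝ n) → (∀ i → t i ≈ 0#) → sum t ≈ 0#
sum-zero {n} t t≈0 = trans (sum-cong t≈0) (sum-replicate-zero n)

sum-single : ∀ {n} (t : Vector ℝ n) x → (∀ y → x ≢ y → t y ≈ 0#) → sum t ≈ t x
sum-single {suc n} t x t≈0 = begin
  sum t                        ≈⟨ sum-remove t ⟩
  t x + sum (removeAt t x)
    ≈⟨ +-cong refl (sum-zero _ λ i → t≈0 (Fin.punchIn x i) (Fin.punchInᵢ≢i x i ∘ ≡.sym)) ⟩
  t x + 0#                     ≈⟨ +-identityʳ (t x) ⟩
  t x                          ∎
  where open ≈-Reasoning

sum-bounds-term : ∀ {n} (t : Vector ℝ n) → (∀ i → 0# ≤ t i) → ∀ x → 0# ≤ sum t - t x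
sum-bounds-term {suc n} t 0≤t x = ≤-respʳ-≈ (begin
  sum (removeAt t x)                   ≈⟨ solve 2 (λ a b → b := (a :+ b) :- a) refl (t x) _ ⟩
  (t x + sum (removeAt t x)) - t x     ≈⟨ +-cong (sum-remove t) refl ⟨
  sum t - t x                          ∎)
  (0≤-sum _ λ i → 0≤t (Fin.punchIn x i))
  where open ≈-Reasoning

-- After the term at `x` is removed, the term at `y` is the one with index `punchOut x≢y` of the
-- remaining vector, where the bound for a single term applies.
sum-bounds-pair : ∀ {n} (t : Vector ℝ n) → (∀ i → 0# ≤ t i) → ∀ {x y} → x ≢ y → 0# ≤ sum t - t x - t y
sum-bounds-pair {suc n} t 0≤t {x} {y} x≢y = ≤-respʳ-≈ (begin
  sum (removeAt t x) - t (Fin.punchIn x z)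
    ≈⟨ solve 3 (λ a b c → b :- c := ((a :+ b) :- a) :- c) refl (t x) _ _ ⟩
  (t x + sum (removeAt t x)) - t x - t (Fin.punchIn x z)
    ≈⟨ +-cong (+-cong (sum-remove t) refl) (-‿cong (reflexive (cong t (≡.sym (Fin.punchIn-punchOut x≢y))))) ⟨
  sum t - t x - t y                             ∎)
  (sum-bounds-term (removeAt t x) (λ i → 0≤t (Fin.punchIn x i)) z)
  where
  open ≈-Reasoning
  z = Fin.punchOut x≢y

diagonal-≡ : ∀ {n} (d : Vector ℝ n) x → diagonal d x x ≡ d x
diagonal-≡ d x = cong (λ b → if b then d x else 0#) (dec-true (x Fin.≟ x) ≡.refl)

diagonal-≢ : ∀ {n} (d : Vector ℝ n) {x y} → x ≢ y → diagonal d x y ≡ 0#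
diagonal-≢ d {x} {y} x≢y = cong (λ b → if b then d x else 0#) (dec-false (x Fin.≟ y) x≢y)

diagonal-·ᵥ : ∀ {n} (d v : Vector ℝ n) x → (diagonal d ·ᵥ v) x ≈ d x * v x
diagonal-·ᵥ d v x = trans
  (sum-single _ x λ y x≢y → trans (*-cong (reflexive (diagonal-≢ d x≢y)) refl) (zeroˡ (v y)))
  (*-cong (reflexive (diagonal-≡ d x)) refl)

⊗-diagonal : ∀ {n} (M : Matrix n) d x y → (M ⊗ diagonal d) x y ≈ M x y * d y
⊗-diagonal M d x y = trans
  (sum-single _ y λ z y≢z → trans (*-cong refl (reflexive (diagonal-≢ d (y≢z ∘ ≡.sym)))) (zeroʳ (M x z)))
  (*-cong refl (reflexive (diagonal-≡ d y)))

-- Stated for `tabulate f` with arbitrary `f` so that the induction can shift `f` by `suc`. Taking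
-- `f` to be the identity gives `allFin`, and with it the row sums of the adjacency matrix.
sum-indicator : ∀ {n p} {A : Set} {P : Pred A p} (P? : Decidable P) (f : Fin n → A) →
  ∑[ i < n ] (if does (P? (f i)) then 1# else 0#) ≈ fromℕ (length (filter P? (List.tabulate f)))
sum-indicator {zero}  P? f = refl
sum-indicator {suc n} P? f with does (P? (f 0F)) | sum-indicator P? (f ∘ Fin.suc)
... | true  | ih = trans (+-cong refl ih) (sym (fromℕ-suc (length (filter P? (List.tabulate (f ∘ Fin.suc))))))
... | false | ih = trans (+-identityˡ _) ih

-- Quadratic forms of the normalized Laplacian and the bounds for one eigenvector.

module NormalizedLaplacian (G : ConnectedGraph) where
  open ConnectedGraph G

  w : Vector ℝ order
  w x = 1# /√ degree x

  sum-adjacency : ∀ x → ∑[ y < order ] adjacency x y ≈ fromℕ (degree x)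
  sum-adjacency x = sum-indicator (adj? x) (λ y → y)

  adjacency-symmetric : ∀ x y → adjacency x y ≡ adjacency y x
  adjacency-symmetric x y with adj? x y | adj? y x
  ... | yes _  | yes _  = ≡.refl
  ... | no _   | no _   = ≡.refl
  ... | yes xy | no ¬yx = ⊥-elim (¬yx (symmetric xy))
  ... | no ¬xy | yes yx = ⊥-elim (¬xy (symmetric yx))

  0≤adjacency : ∀ x y → 0# ≤ adjacency x y
  0≤adjacency x y with does (adj? x y)
  ... | true  = 0≤fromℕ 1
  ... | false = 0≤0

  normalizedLaplacian-·ᵥ : ∀ v x →
    (normalizedLaplacian ·ᵥ v) x ≈ v x - w x * ∑[ y < order ] (adjacency x y * (w y * v y))
  normalizedLaplacian-·ᵥ v x = begin
    ∑[ y < order ] ((identity x y - (D^-½ ⊗ adjacency ⊗ D^-½) x y) * v y)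
      ≈⟨ sum-cong (λ y → *-cong (+-cong refl (-‿cong (trans (⊗-diagonal (D^-½ ⊗ adjacency) w x y)
          -- By definition, column `y` of `D^-½ ⊗ adjacency` is `D^-½` applied to column `y` of
          -- `adjacency`.
          (*-cong (diagonal-·ᵥ w (λ z → adjacency z y) x) refl)))) refl) ⟩
    ∑[ y < order ] ((identity x y - (w x * adjacency x y) * w y) * v y)
      ≈⟨ sum-cong (λ y → solve 5 (λ i p a q v → (i :- (p :* a) :* q) :* v := i :* v :+ (:- p) :* (a :* (q :* v)))
          refl (identity x y) (w x) (adjacency x y) (w y) (v y)) ⟩
    ∑[ y < order ] (identity x y * v y + - w x * (adjacency x y * (w y * v y)))
      ≈⟨ ∑-distrib-+ (λ y → identity x y * v y) (λ y → - w x * (adjacency x y * (w y * v y))) ⟩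
    ∑[ y < order ] (identity x y * v y) + ∑[ y < order ] (- w x * (adjacency x y * (w y * v y)))
      ≈⟨ +-cong (diagonal-·ᵥ (λ _ → 1#) v x) (sym (*-distribˡ-sum (- w x) (λ y → adjacency x y * (w y * v y)))) ⟩
    1# * v x + - w x * ∑[ y < order ] (adjacency x y * (w y * v y))
      ≈⟨ solve 3 (λ v p s → ⟨1⟩ :* v :+ (:- p) :* s := v :- p :* s) refl (v x) (w x) _ ⟩
    v x - w x * ∑[ y < order ] (adjacency x y * (w y * v y)) ∎
    where open ≈-Reasoning

  -- Repeats the summand of `edgeDerivative` literally, so that `edgeDerivative` unfolds to the mean
  -- of these terms over the basis.
  derivativeTerm : ℝ → Vector ℝ order → Vertex → Vertex → ℝ
  derivativeTerm λ₀ v x y =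
    (1# - λ₀) * (v x * v x /ℕ degree x + v y * v y /ℕ degree y)
      - fromℕ 2 * (v x * v y /√ (degree x ℕ.* degree y))

  derivativeTerm-≈ : ∀ λ₀ v x y → derivativeTerm λ₀ v x y ≈
    (1# - λ₀) * ((w x * v x) * (w x * v x) + (w y * v y) * (w y * v y)) - fromℕ 2 * ((w x * v x) * (w y * v y))
  derivativeTerm-≈ λ₀ v x y = begin
    derivativeTerm λ₀ v x y
      ≈⟨ +-cong (*-cong refl (+-cong (/ℕ-≈ (v x * v x) (degree x)) (/ℕ-≈ (v y * v y) (degree y))))
          (-‿cong (*-cong refl (/√-*-≈ (v x * v y) (degree x) (degree y)))) ⟩
    (1# - λ₀) * (v x * v x * (w x * w x) + v y * v y * (w y * w y)) - fromℕ 2 * (v x * v y * (w x * w y))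
      ≈⟨ solve 5 (λ l a b p q →
          (⟨1⟩ :- l) :* (a :* a :* (p :* p) :+ b :* b :* (q :* q)) :- ⟨2⟩ :* (a :* b :* (p :* q)) :=
          (⟨1⟩ :- l) :* ((p :* a) :* (p :* a) :+ (q :* b) :* (q :* b)) :- ⟨2⟩ :* ((p :* a) :* (q :* b)))
          refl λ₀ (v x) (v y) (w x) (w y) ⟩
    (1# - λ₀) * ((w x * v x) * (w x * v x) + (w y * v y) * (w y * v y)) - fromℕ 2 * ((w x * v x) * (w y * v y)) ∎
    where open ≈-Reasoning

  derivativeTerm-cong : ∀ λ₀ v x y {a b} → w x * v x ≈ a → w y * v y ≈ b →
    derivativeTerm λ₀ v x y ≈ (1# - λ₀) * (a * a + b * b) - fromℕ 2 * (a * b)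
  derivativeTerm-cong λ₀ v x y wv≈a wv≈b = trans (derivativeTerm-≈ λ₀ v x y)
    (+-cong (*-cong refl (+-cong (*-cong wv≈a wv≈a) (*-cong wv≈b wv≈b)))
      (-‿cong (*-cong refl (*-cong wv≈a wv≈b))))

  module UnitEigenvector {λ₀ : ℝ} {v : Vector ℝ order}
    (v∈ : InEigenspace λ₀ v) (unit : ⟨ v , v ⟩ ≈ 1#) where

    f : Vector ℝ order
    f x = w x * v x

    adjacencyForm : ℝ
    adjacencyForm = ∑[ x < order ] ∑[ y < order ] (adjacency x y * (f x * f y))

    -- The form is ⟨v, D^(-1/2) A D^(-1/2) v⟩ = ⟨v, (I - L) v⟩, where L v = λ₀ v and v has norm 1.
    adjacencyForm-≈ : adjacencyForm ≈ 1# - λ₀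
    adjacencyForm-≈ = begin
      ∑[ x < order ] ∑[ y < order ] (adjacency x y * (f x * f y))
        ≈⟨ sum-cong row ⟩
      ∑[ x < order ] ((1# - λ₀) * (v x * v x))
        ≈⟨ *-distribˡ-sum (1# - λ₀) (λ x → v x * v x) ⟨
      (1# - λ₀) * ⟨ v , v ⟩
        ≈⟨ *-cong refl unit ⟩
      (1# - λ₀) * 1#
        ≈⟨ *-identityʳ (1# - λ₀) ⟩
      1# - λ₀ ∎
      where
      open ≈-Reasoning
      row : ∀ x → ∑[ y < order ] (adjacency x y * (f x * f y)) ≈ (1# - λ₀) * (v x * v x)
      row x = begin
        ∑[ y < order ] (adjacency x y * (f x * f y))
          ≈⟨ sum-cong (λ y → solve 3 (λ a b c → a :* (b :* c) := b :* (a :* c)) refl (adjacency x y) (f x) (f y)) ⟩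
        ∑[ y < order ] (f x * (adjacency x y * f y))
          ≈⟨ *-distribˡ-sum (f x) (λ y → adjacency x y * f y) ⟨
        f x * S
          -- Adding and subtracting `v x` brings out `v x - w x * S`, the entry of L v at `x`, to
          -- which the eigenvalue equation applies.
          ≈⟨ solve 3 (λ p v s → p :* v :* s := v :* (v :- (v :- p :* s))) refl (w x) (v x) S ⟩
        v x * (v x - (v x - w x * S))
          ≈⟨ *-cong refl (+-cong refl (-‿cong (trans (sym (normalizedLaplacian-·ᵥ v x)) (v∈ x)))) ⟩
        v x * (v x - λ₀ * v x)
          ≈⟨ solve 2 (λ v l → v :* (v :- l :* v) := (⟨1⟩ :- l) :* (v :* v)) refl (v x) λ₀ ⟩
        (1# - λ₀) * (v x * v x) ∎
        where
        S = ∑[ y < order ] (adjacency x y * f y)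

    -- Row `x` of the adjacency matrix sums to the degree of `x`, and the degree times (f x)² is (v
    -- x)². The double sum is therefore ⟨v, v⟩.
    degreeForm-≈ : ∑[ x < order ] ∑[ y < order ] (adjacency x y * (f x * f x)) ≈ 1#
    degreeForm-≈ = trans (sum-cong row) unit
      where
      open ≈-Reasoning
      row : ∀ x → ∑[ y < order ] (adjacency x y * (f x * f x)) ≈ v x * v x
      row x = begin
        ∑[ y < order ] (adjacency x y * (f x * f x))
          ≈⟨ *-distribʳ-sum (f x * f x) (adjacency x) ⟨
        sum (adjacency x) * (f x * f x)
          ≈⟨ *-cong (sum-adjacency x) refl ⟩
        fromℕ (degree x) * (f x * f x)
          ≈⟨ solve 3 (λ d w v → d :* ((w :* v) :* (w :* v)) := (d :* (w :* w)) :* (v :* v)) refl (fromℕ (degree x)) (w x) (v x) ⟩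
        (fromℕ (degree x) * (w x * w x)) * (v x * v x)
          ≈⟨ *-cong (fromℕ-/√² (degree x)) refl ⟩
        1# * (v x * v x)
          ≈⟨ *-identityˡ (v x * v x) ⟩
        v x * v x ∎

    degreeForm′-≈ : ∑[ x < order ] ∑[ y < order ] (adjacency x y * (f y * f y)) ≈ 1#
    degreeForm′-≈ = begin
      ∑[ x < order ] ∑[ y < order ] (adjacency x y * (f y * f y))
        ≈⟨ ∑-comm (λ x y → adjacency x y * (f y * f y)) ⟩
      ∑[ y < order ] ∑[ x < order ] (adjacency x y * (f y * f y))
        ≈⟨ sum-cong (λ y → sum-cong λ x → *-cong (reflexive (adjacency-symmetric x y)) refl) ⟩
      ∑[ y < order ] ∑[ x < order ] (adjacency y x * (f y * f y))
        ≈⟨ degreeForm-≈ ⟩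
      1# ∎
      where open ≈-Reasoning

    ∑∑-+ : (g h : Matrix order) → ∑[ x < order ] ∑[ y < order ] (g x y + h x y) ≈
      ∑[ x < order ] ∑[ y < order ] g x y + ∑[ x < order ] ∑[ y < order ] h x y
    ∑∑-+ g h = trans (sum-cong λ x → ∑-distrib-+ (g x) (h x)) (∑-distrib-+ (λ x → sum (g x)) (λ x → sum (h x)))

    -- ∑ₓᵧ Aₓᵧ (f x + σ f y)² = 2 + 2 σ (1 − λ₀) for σ = ±1.
    0≤1+σ[1-λ₀] : ∀ σ → σ * σ ≈ 1# → 0# ≤ 1# + σ * (1# - λ₀)
    0≤1+σ[1-λ₀] σ σ²≈1 = ≤-respʳ-≈ (begin
      fromℚ ½ * ∑[ x < order ] ∑[ y < order ] (adjacency x y * ((f x + σ * f y) * (f x + σ * f y)))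
        ≈⟨ *-cong refl (sum-cong λ x → sum-cong λ y → expand (adjacency x y) (f x) (f y)) ⟩
      fromℚ ½ * ∑[ x < order ] ∑[ y < order ]
        ((adjacency x y * (f x * f x) + adjacency x y * (f y * f y)) + (fromℕ 2 * σ) * (adjacency x y * (f x * f y)))
        ≈⟨ *-cong refl (trans (∑∑-+ (λ x y → adjacency x y * (f x * f x) + adjacency x y * (f y * f y)) _)
            (+-cong (∑∑-+ (λ x y → adjacency x y * (f x * f x)) _) scale)) ⟩
      fromℚ ½ * (∑[ x < order ] ∑[ y < order ] (adjacency x y * (f x * f x))
        + ∑[ x < order ] ∑[ y < order ] (adjacency x y * (f y * f y)) + (fromℕ 2 * σ) * adjacencyForm)
        ≈⟨ *-cong refl (+-cong (+-cong degreeForm-≈ degreeForm′-≈) (*-cong refl adjacencyForm-≈)) ⟩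
      fromℚ ½ * (1# + 1# + (fromℕ 2 * σ) * (1# - λ₀))
        ≈⟨ solve 2 (λ σ l → con ½ :* (⟨1⟩ :+ ⟨1⟩ :+ (⟨2⟩ :* σ) :* (⟨1⟩ :- l)) := ⟨1⟩ :+ σ :* (⟨1⟩ :- l)) refl σ λ₀ ⟩
      1# + σ * (1# - λ₀) ∎)
      (0≤-* (nonNeg (fromℚ ½) λ _ → ℚ.nonNegative⁻¹ ½)
        (0≤-sum _ λ x → 0≤-sum _ λ y → 0≤-* (0≤adjacency x y) (0≤x² (f x + σ * f y))))
      where
      open ≈-Reasoning
      expand : ∀ a b c → a * ((b + σ * c) * (b + σ * c)) ≈ (a * (b * b) + a * (c * c)) + (fromℕ 2 * σ) * (a * (b * c))
      expand a b c = begin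
        a * ((b + σ * c) * (b + σ * c))
          ≈⟨ solve 4 (λ a b c s → a :* ((b :+ s :* c) :* (b :+ s :* c)) :=
              (a :* (b :* b) :+ a :* ((s :* s) :* (c :* c))) :+ (⟨2⟩ :* s) :* (a :* (b :* c))) refl a b c σ ⟩
        (a * (b * b) + a * ((σ * σ) * (c * c))) + (fromℕ 2 * σ) * (a * (b * c))
          ≈⟨ +-cong (+-cong refl (*-cong refl (trans (*-cong σ²≈1 refl) (*-identityˡ (c * c))))) refl ⟩
        (a * (b * b) + a * (c * c)) + (fromℕ 2 * σ) * (a * (b * c)) ∎
      scale : ∑[ x < order ] ∑[ y < order ] ((fromℕ 2 * σ) * (adjacency x y * (f x * f y))) ≈ (fromℕ 2 * σ) * adjacencyForm
      scale = sym (trans (*-distribˡ-sum (fromℕ 2 * σ) (λ x → ∑[ y < order ] (adjacency x y * (f x * f y))))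
        (sum-cong λ x → *-distribˡ-sum (fromℕ 2 * σ) (λ y → adjacency x y * (f x * f y))))

    -- The difference splits into the mass of v away from `x` and `y`, plus (v x)² (1 - 1/d) with d
    -- the degree of `x`, plus the same term for `y`; each part is non-negative.
    0≤1-f²-f² : ∀ {x y} → x ≢ y → 0# ≤ 1# - f x * f x - f y * f y
    0≤1-f²-f² {x} {y} x≢y = ≤-respʳ-≈ (begin
      (⟨ v , v ⟩ - v x * v x - v y * v y) + (v x * v x * (1# - w x * w x) + v y * v y * (1# - w y * w y))
        ≈⟨ solve 5 (λ n a b p q → (n :- a :* a :- b :* b) :+ (a :* a :* (⟨1⟩ :- p :* p) :+ b :* b :* (⟨1⟩ :- q :* q)) :=
            n :- (p :* a) :* (p :* a) :- (q :* b) :* (q :* b)) refl ⟨ v , v ⟩ (v x) (v y) (w x) (w y) ⟩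
      ⟨ v , v ⟩ - f x * f x - f y * f y
        ≈⟨ +-cong (+-cong unit refl) refl ⟩
      1# - f x * f x - f y * f y ∎)
      (0≤-+ (sum-bounds-pair (λ z → v z * v z) (λ z → 0≤x² (v z)) x≢y)
        (0≤-+ (0≤-* (0≤x² (v x)) (/√²-≤1 (degree x))) (0≤-* (0≤x² (v y)) (/√²-≤1 (degree y)))))
      where open ≈-Reasoning

    -- At σ = 1 the right-hand side is λ₀ + derivativeTerm, at σ = −1 it is (2 − λ₀) − derivativeTerm.
    derivativeTerm-bound : ∀ {x y} → x ≢ y → ∀ σ → σ * σ ≈ 1# →
      0# ≤ (1# - σ * (1# - λ₀)) + σ * derivativeTerm λ₀ v x y
    derivativeTerm-bound {x} {y} x≢y σ σ²≈1 = ≤-respʳ-≈ (begin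
      (f x + - σ * f y) * (f x + - σ * f y) + (1# + - σ * (1# - λ₀)) * (1# - f x * f x - f y * f y)
        ≈⟨ solve 4 (λ a b s l →
            (a :+ (:- s) :* b) :* (a :+ (:- s) :* b) :+ (⟨1⟩ :+ (:- s) :* (⟨1⟩ :- l)) :* (⟨1⟩ :- a :* a :- b :* b) :=
            ((⟨1⟩ :- s :* (⟨1⟩ :- l)) :+ s :* ((⟨1⟩ :- l) :* (a :* a :+ b :* b) :- ⟨2⟩ :* (a :* b))) :+ (s :* s :- ⟨1⟩) :* (b :* b))
            refl (f x) (f y) σ λ₀ ⟩
      (1# - σ * (1# - λ₀)) + σ * T + (σ * σ - 1#) * (f y * f y)
        ≈⟨ +-cong (+-cong refl (*-cong refl (derivativeTerm-≈ λ₀ v x y))) (*-cong (+-cong (sym σ²≈1) refl) refl) ⟨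
      (1# - σ * (1# - λ₀)) + σ * derivativeTerm λ₀ v x y + (1# - 1#) * (f y * f y)
        ≈⟨ solve 2 (λ a b → a :+ (⟨1⟩ :- ⟨1⟩) :* b := a) refl ((1# - σ * (1# - λ₀)) + σ * derivativeTerm λ₀ v x y) (f y * f y) ⟩
      (1# - σ * (1# - λ₀)) + σ * derivativeTerm λ₀ v x y ∎)
      (0≤-+ (0≤x² (f x + - σ * f y))
        (0≤-* (0≤1+σ[1-λ₀] (- σ) (trans (solve 1 (λ s → (:- s) :* (:- s) := s :* s) refl σ) σ²≈1)) (0≤1-f²-f² x≢y)))
      where
      open ≈-Reasoning
      T = (1# - λ₀) * (f x * f x + f y * f y) - fromℕ 2 * (f x * f y)

  -- Every vector of an orthonormal basis is a unit eigenvector, so the bound for a single term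
  -- averages over the basis. The signs `σ = 1` and `σ = - 1#` yield the lower and the upper bound.
  edgeDerivative-bound : ∀ {λ₀ k} (ev : IsEigenvalue λ₀) (B : OrthonormalEigenbasis λ₀ k) {x y} →
    Adj x y → ∀ σ → σ * σ ≈ 1# → 0# ≤ (1# - σ * (1# - λ₀)) + σ * edgeDerivative ev B x y
  edgeDerivative-bound {λ₀} {k} ev B {x} {y} xy σ σ²≈1 =
    0≤-mean-affine k {{multiplicity-nonZero ev B}} σ (1# - σ * (1# - λ₀)) (λ i → derivativeTerm λ₀ (vector i) x y)
      λ i → UnitEigenvector.derivativeTerm-bound (inEigenspace i)
        (trans (orthonormal i i) (reflexive (diagonal-≡ (λ _ → 1#) i)))
        (λ x≡y → loopless x≡y xy) σ σ²≈1
    where open OrthonormalEigenbasis B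

-- The complete graph on two vertices.

/√1-≈ : 1# /√ 1 ≈ 1#
/√1-≈ = inverse-unique (√-inverse 1) (trans (*-identityʳ (√ 1))
  (positive-square-injective (√-positive 1) (fromℕ-positive 1) (trans (√-square 1) (sym (*-identityˡ 1#)))))

1≉0 : ¬ 1# ≈ 0#
1≉0 1≈0 with close 1≈0 1ℚ (ℚ.positive⁻¹ 1ℚ)
... | N , h = ℚ.<-irrefl ≡.refl (h N ℕ.≤-refl)

K₂ : ConnectedGraph
K₂ = record
  { order     = 2
  ; 2≤order   = ℕ.≤-refl
  ; Adj       = _≢_
  ; adj?      = λ x y → ¬? (x Fin.≟ y)
  ; symmetric = λ x≢y → x≢y ∘ ≡.sym
  ; loopless  = λ x≡y x≢y → x≢y x≡y
  ; connected = connected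
  }
  where
  connected : ∀ (x y : Fin 2) → Star _≢_ x y
  connected x y with x Fin.≟ y
  ... | yes ≡.refl = ε
  ... | no  x≢y    = x≢y ◅ ε

module K₂ where
  open ConnectedGraph K₂
  open NormalizedLaplacian K₂

  w-≈ : ∀ x → w x ≈ 1#
  w-≈ 0F = /√1-≈
  w-≈ 1F = /√1-≈

  w-* : ∀ x a → w x * a ≈ a
  w-* x a = trans (*-cong (w-≈ x) refl) (*-identityˡ a)

  normalizedLaplacian-0 : ∀ v → (normalizedLaplacian ·ᵥ v) 0F ≈ v 0F - v 1F
  normalizedLaplacian-0 v = trans (normalizedLaplacian-·ᵥ v 0F)
    (+-cong refl (-‿cong (trans (w-* 0F _)
      -- The adjacency entries of row 0 compute to `0#` and `1#`; the last `⟨0⟩` is the empty sum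
      -- that ends `sum`.
      (trans (solve 2 (λ a b → ⟨0⟩ :* a :+ (⟨1⟩ :* b :+ ⟨0⟩) := b) refl (w 0F * v 0F) (w 1F * v 1F)) (w-* 1F (v 1F))))))

  normalizedLaplacian-1 : ∀ v → (normalizedLaplacian ·ᵥ v) 1F ≈ v 1F - v 0F
  normalizedLaplacian-1 v = trans (normalizedLaplacian-·ᵥ v 1F)
    (+-cong refl (-‿cong (trans (w-* 1F _)
      (trans (solve 2 (λ a b → ⟨1⟩ :* a :+ (⟨0⟩ :* b :+ ⟨0⟩) := a) refl (w 0F * v 0F) (w 1F * v 1F)) (w-* 0F (v 0F))))))

  -- The eigenvalues of K₂ are 1 − σ for σ = ±1, with unit eigenvector (1, σ)/√2.
  module Eigenpair {σ s : ℝ} (σ²≈1 : σ * σ ≈ 1#) (2s²≈1 : fromℕ 2 * (s * s) ≈ 1#) where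
    open ≈-Reasoning

    v : Vector ℝ 2
    v 0F = s
    v 1F = σ * s

    v∈ : InEigenspace (1# - σ) v
    v∈ 0F = trans (normalizedLaplacian-0 v)
      (solve 2 (λ s σ → s :- σ :* s := (⟨1⟩ :- σ) :* s) refl s σ)
    v∈ 1F = begin
      (normalizedLaplacian ·ᵥ v) 1F      ≈⟨ normalizedLaplacian-1 v ⟩
      σ * s - s                          ≈⟨ +-cong refl (-‿cong (trans (*-cong σ²≈1 refl) (*-identityˡ s))) ⟨
      σ * s - σ * σ * s
        ≈⟨ solve 2 (λ s σ → σ :* s :- σ :* σ :* s := (⟨1⟩ :- σ) :* (σ :* s)) refl s σ ⟩
      (1# - σ) * (σ * s)                 ∎

    isEigenvalue : IsEigenvalue (1# - σ)
    isEigenvalue = v , v∈ , λ v≈0 → 1≉0 (begin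
      1#                    ≈⟨ 2s²≈1 ⟨
      fromℕ 2 * (s * s)     ≈⟨ *-cong refl (*-cong (v≈0 0F) refl) ⟩
      fromℕ 2 * (0# * s)    ≈⟨ solve 1 (λ s → ⟨2⟩ :* (⟨0⟩ :* s) := ⟨0⟩) refl s ⟩
      0#                    ∎)

    unit : ⟨ v , v ⟩ ≈ 1#
    unit = begin
      s * s + (σ * s * (σ * s) + 0#)
        ≈⟨ solve 2 (λ s σ → s :* s :+ (σ :* s :* (σ :* s) :+ ⟨0⟩) := (⟨1⟩ :+ σ :* σ) :* (s :* s)) refl s σ ⟩
      (1# + σ * σ) * (s * s)
        ≈⟨ *-cong (trans (+-cong refl σ²≈1) (solve 0 (⟨1⟩ :+ ⟨1⟩ := ⟨2⟩) refl)) refl ⟩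
      fromℕ 2 * (s * s)                  ≈⟨ 2s²≈1 ⟩
      1#                                 ∎

    -- The first row of the eigenvalue equation, u₀ - u₁ = (1 - σ) u₀, already determines u₁ from
    -- u₀; hence the eigenspace is one-dimensional.
    eigenspace-σ : ∀ {u} → InEigenspace (1# - σ) u → u 1F ≈ σ * u 0F
    eigenspace-σ {u} u∈ = begin
      u 1F                             ≈⟨ solve 2 (λ a b → b := a :- (a :- b)) refl (u 0F) (u 1F) ⟩
      u 0F - (u 0F - u 1F)
        ≈⟨ +-cong refl (-‿cong (trans (sym (normalizedLaplacian-0 u)) (u∈ 0F))) ⟩
      u 0F - (1# - σ) * u 0F           ≈⟨ solve 2 (λ a σ → a :- (⟨1⟩ :- σ) :* a := σ :* a) refl (u 0F) σ ⟩
      σ * u 0F                         ∎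

    basis : OrthonormalEigenbasis (1# - σ) 1
    basis = record
      { vector       = λ _ → v
      ; inEigenspace = λ _ → v∈
      ; orthonormal  = λ { 0F 0F → unit }
      -- The coefficient is u₀ / s, which equals 2 s u₀ because 2 s² = 1.
      ; spanning     = λ u u∈ → (λ _ → fromℕ 2 * s * u 0F) , coordinates u u∈
      }
      where
      coordinates : ∀ u → InEigenspace (1# - σ) u → ∀ x → u x ≈ fromℕ 2 * s * u 0F * v x + 0#
      coordinates u u∈ 0F = begin
        u 0F                               ≈⟨ *-identityˡ (u 0F) ⟨
        1# * u 0F                          ≈⟨ *-cong 2s²≈1 refl ⟨
        fromℕ 2 * (s * s) * u 0F
          ≈⟨ solve 2 (λ s a → ⟨2⟩ :* (s :* s) :* a := ⟨2⟩ :* s :* a :* s :+ ⟨0⟩) refl s (u 0F) ⟩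
        fromℕ 2 * s * u 0F * s + 0#        ∎
      coordinates u u∈ 1F = begin
        u 1F                               ≈⟨ eigenspace-σ u∈ ⟩
        σ * u 0F                           ≈⟨ *-identityˡ (σ * u 0F) ⟨
        1# * (σ * u 0F)                    ≈⟨ *-cong 2s²≈1 refl ⟨
        fromℕ 2 * (s * s) * (σ * u 0F)
          ≈⟨ solve 3 (λ s σ a → ⟨2⟩ :* (s :* s) :* (σ :* a) := ⟨2⟩ :* s :* a :* (σ :* s) :+ ⟨0⟩)
              refl s σ (u 0F) ⟩
        fromℕ 2 * s * u 0F * (σ * s) + 0#  ∎

    -- Here 1 - λ₀ = σ, so the term is σ (s² + σ² s²) - 2 σ s² = (σ² - 1) σ s², and σ² = 1.
    derivativeTerm-zero : derivativeTerm (1# - σ) v 0F 1F ≈ 0#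
    derivativeTerm-zero = begin
      derivativeTerm (1# - σ) v 0F 1F
        ≈⟨ derivativeTerm-cong (1# - σ) v 0F 1F (w-* 0F s) (w-* 1F (σ * s)) ⟩
      (1# - (1# - σ)) * (s * s + σ * s * (σ * s)) - fromℕ 2 * (s * (σ * s))
        ≈⟨ solve 2 (λ s σ → (⟨1⟩ :- (⟨1⟩ :- σ)) :* (s :* s :+ σ :* s :* (σ :* s)) :- ⟨2⟩ :* (s :* (σ :* s)) :=
            (σ :* σ :- ⟨1⟩) :* (σ :* (s :* s))) refl s σ ⟩
      (σ * σ - 1#) * (σ * (s * s))
        ≈⟨ *-cong (+-cong σ²≈1 refl) refl ⟩
      (1# - 1#) * (σ * (s * s))
        ≈⟨ solve 1 (λ a → (⟨1⟩ :- ⟨1⟩) :* a := ⟨0⟩) refl (σ * (s * s)) ⟩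
      0# ∎

    edgeDerivative-zero : edgeDerivative isEigenvalue basis 0F 1F ≈ 0#
    edgeDerivative-zero = trans (*-cong (trans (+-identityʳ (derivativeTerm (1# - σ) v 0F 1F)) derivativeTerm-zero) refl)
      (zeroˡ (inv (fromℕ 1) (fromℕ-positive 1)))

-- The two bounds for every graph, and equality in each on K₂.

open ConnectedGraph

theorem2p19 : ((G : ConnectedGraph) (λ₀ : ℝ) (ev : IsEigenvalue G λ₀)
    (k : ℕ) (B : OrthonormalEigenbasis G λ₀ k)
    (x y : Vertex G) → Adj G x y →
    (- λ₀ ≤ edgeDerivative G ev B x y) × (edgeDerivative G ev B x y ≤ fromℕ 2 - λ₀))
    × (Σ[ G ∈ ConnectedGraph ] Σ[ λ₀ ∈ ℝ ] Σ[ ev ∈ IsEigenvalue G λ₀ ]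
    Σ[ k ∈ ℕ ] Σ[ B ∈ OrthonormalEigenbasis G λ₀ k ]
    Σ[ x ∈ Vertex G ] Σ[ y ∈ Vertex G ] (Adj G x y × edgeDerivative G ev B x y ≈ - λ₀))
    × (Σ[ G ∈ ConnectedGraph ] Σ[ λ₀ ∈ ℝ ] Σ[ ev ∈ IsEigenvalue G λ₀ ]
    Σ[ k ∈ ℕ ] Σ[ B ∈ OrthonormalEigenbasis G λ₀ k ]
    Σ[ x ∈ Vertex G ] Σ[ y ∈ Vertex G ] (Adj G x y × edgeDerivative G ev B x y ≈ fromℕ 2 - λ₀))
-- For `σ = 1` the eigenvalue of K₂ is 0 and the lower bound is 0; for `σ = - 1#` it is 2 and the
-- upper bound is 0. The edge derivative is 0 in both cases.
theorem2p19 = bounds , tight 1# (*-identityˡ 1#) {λ λ₀ → - λ₀} lower , tight (- 1#) [-1]²≈1 {λ λ₀ → fromℕ 2 - λ₀} upper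
  where
  [-1]²≈1 : - 1# * - 1# ≈ 1#
  [-1]²≈1 = solve 0 ((:- ⟨1⟩) :* (:- ⟨1⟩) := ⟨1⟩) refl

  bounds : (G : ConnectedGraph) (λ₀ : ℝ) (ev : IsEigenvalue G λ₀)
    (k : ℕ) (B : OrthonormalEigenbasis G λ₀ k) (x y : Vertex G) → Adj G x y →
    (- λ₀ ≤ edgeDerivative G ev B x y) × (edgeDerivative G ev B x y ≤ fromℕ 2 - λ₀)
  bounds G λ₀ ev k B x y xy =
    0≤y-x⇒x≤y (≤-respʳ-≈
      (solve 2 (λ l d → (⟨1⟩ :- ⟨1⟩ :* (⟨1⟩ :- l)) :+ ⟨1⟩ :* d := d :- (:- l)) refl λ₀ D)
      (bound 1# (*-identityˡ 1#))) ,
    0≤y-x⇒x≤y (≤-respʳ-≈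
      (solve 2 (λ l d → (⟨1⟩ :- (:- ⟨1⟩) :* (⟨1⟩ :- l)) :+ (:- ⟨1⟩) :* d := (⟨2⟩ :- l) :- d) refl λ₀ D)
      (bound (- 1#) [-1]²≈1))
    where
    D = edgeDerivative G ev B x y
    bound = NormalizedLaplacian.edgeDerivative-bound G ev B xy

  -- Here `f` gives the bound as a function of the eigenvalue, so that one example serves both
  -- bounds.
  tight : ∀ σ → σ * σ ≈ 1# → {f : ℝ → ℝ} → 0# ≈ f (1# - σ) →
    Σ[ G ∈ ConnectedGraph ] Σ[ λ₀ ∈ ℝ ] Σ[ ev ∈ IsEigenvalue G λ₀ ]
    Σ[ k ∈ ℕ ] Σ[ B ∈ OrthonormalEigenbasis G λ₀ k ]
    Σ[ x ∈ Vertex G ] Σ[ y ∈ Vertex G ] (Adj G x y × edgeDerivative G ev B x y ≈ f λ₀)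
  tight σ σ²≈1 0≈f = K₂ , 1# - σ , isEigenvalue , 1 , basis , 0F , 1F , (λ ()) , trans edgeDerivative-zero 0≈f
    -- The normalizing factor `s` is 1/√2, found by unification from 2 (1/√2)² = 1.
    where open K₂.Eigenpair σ²≈1 (fromℕ-/√² 2)

  lower : 0# ≈ - (1# - 1#)
  lower = solve 0 (⟨0⟩ := :- (⟨1⟩ :- ⟨1⟩)) refl

  upper : 0# ≈ fromℕ 2 - (1# - - 1#)
  upper = solve 0 (⟨0⟩ := ⟨2⟩ :- (⟨1⟩ :- (:- ⟨1⟩))) refl
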